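{- Given $f_1,\dots,f_k\in D[x]$, let $\mathbf f\colon\widehat D\to\widehat D^k$ be the map $a\mapsto(f_1(a),\dots,f_k(a))$. If $X\subseteq\widehat D^k$ is openly Eulerian, with closure $\widehat X$, then the procounting distribution $\mu_{\mathbf f^{ -1}(\widehat X)}$ exists.
   Context: $F$ is a global field, $\mathcal S$ a nonempty finite set of places of $F$ containing the archimedean ones, $D$ the ring of $\mathcal S$-integers of $F$. $\widehat D=\varprojlim D/\mathfrak a$ over non-zero ideals $\mathfrak a$, and $\widehat D_{\mathfrak p}=\varprojlim D/\mathfrak p^j$ for each non-zero prime $\mathfrak p$, so that $\widehat D=\prod_{\mathfrak p}\widehat D_{\mathfrak p}$; $\widehat\pi_{\mathfrak a}\colon\widehat D\to D/\mathfrak a$ and $\widehat\pi_{\mathfrak p^\infty}\colon\widehat D^k\to\widehat D_{\mathfrak p}^k$ are the projections and $\mu_{\widehat D}$ is the normalized Haar measure. For $X\subseteq\widehat D^k$, $\widehat X$ is its closure and $X(\mathfrak p)$ is the closure of $\widehat\pi_{\mathfrak p^\infty}(X)$ in $\widehat D_{\mathfrak p}^k$. $X$ is Eulerian if $\widehat X=\prod_{\mathfrak p}X(\mathfrak p)$, and openly Eulerian if moreover every $X(\mathfrak p)$ is open. For nonempty $S\subseteq\widehat D$ let $\widetilde\mu_{S,\mathfrak a}:=\frac{|D/\mathfrak a|}{|\widehat\pi_{\mathfrak a}(S)|}\mathbf 1_{\widehat\pi_{\mathfrak a}^{ -1}(\widehat\pi_{\mathfrak a}(S))}\cdot\mu_{\widehat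 D}$, and $\widetilde\mu_{\emptyset,\mathfrak a}:=0$. The procounting distribution is $\mu_S:=\lim_{\mathfrak a\to0}\widetilde\mu_{S,\mathfrak a}$ (if it exists), the net being indexed by non-zero ideals ordered by divisibility and the limit being in the weak-* sense (convergence of $\widetilde\mu_{S,\mathfrak a}(\mathbf 1_U)$ for every compact open $U\subseteq\widehat D$). -}

module Defs where

open import Level using (Level; 0ℓ; _⊔_) renaming (suc to lsuc)
open import Algebra.Bundles using (CommutativeRing; RawRing)
open import Algebra.Apartness.Bundles using (HeytingField; HeytingCommutativeRing)
import Algebra.Apartness.Properties.HeytingCommutativeRing as HeytingProperties
open import Algebra.Morphism.Structures using (IsRingHomomorphism; IsRingMonomorphism)
import Algebra.Morphism.RingMonomorphism as RingMonomorphism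
import Algebra.Definitions.RawMonoid as RawMonoidOps
import Algebra.Properties.Ring as RingProperties
import Algebra.Properties.AbelianGroup as AbelianGroupProperties
import Relation.Binary.Reasoning.Setoid as ≈-Reasoning
open import Axiom.ExcludedMiddle using (ExcludedMiddle)
open import Data.Nat.Base using (ℕ; zero; suc)
open import Data.Nat.Primality using (Prime)
open import Data.Fin.Base using (Fin; toℕ)
import Data.Integer.Base as ℤ
open import Data.List.Base using (List; []; _∷_; map; catMaybes)
open import Data.List.Relation.Unary.All using (All)
open import Data.List.Relation.Unary.Any using (Any; here; there)
open import Data.Maybe.Base using (Maybe; just; nothing)
open import Data.Product using (Σ; ∃; _×_; _,_; proj₁; proj₂)
open import Data.Sum using (_⊎_; inj₁; inj₂)
open import Data.Rational as ℚ using (ℚ; 0ℚ; 1ℚ)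
import Data.Rational.Properties as ℚ
open import Function using (_⇔_; Bijection)
open import Relation.Binary.Bundles using (Setoid)
open import Relation.Binary.Core using (Rel)
import Relation.Binary.Construct.On as On
open import Relation.Binary.PropositionalEquality using (_≡_)
import Relation.Binary.PropositionalEquality as ≡
open import Relation.Nullary using (¬_; yes; no; contradiction)
open import Relation.Unary using (Pred; _∈_; _∉_; _⊆_; _≐_; _∩_; _∪_; ∁; U; Empty)

-- Real numbers as Cauchy sequences of rationals.
module Reals where
  open import Data.Nat.Base using (ℕ) renaming (_≤_ to _≤ₙ_; _⊔_ to _⊔ₙ_)
  import Data.Nat.Properties as ℕ
  open import Data.Product using (∃; _×_; _,_; proj₁; proj₂)
  open import Data.Sum using (_⊎_; inj₁; inj₂)
  open import Data.Rational as ℚ using (ℚ; 0ℚ; 1ℚ; ½; _+_; _*_; _-_; -_; ∣_∣; _≤_; _<_; Positive; NonNegative)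
  import Data.Rational.Properties as ℚ
  open import Data.Rational.Solver using (module +-*-Solver)
  open import Relation.Nullary using (¬_; yes; no; contradiction)
  open import Relation.Binary.PropositionalEquality using (_≡_; refl; sym; trans; cong; cong₂; subst; subst₂)

  halve : ∀ {ε} → 0ℚ < ε → ∃ λ η → 0ℚ < η × η + η ≡ ε
  halve {ε} p = ½ * ε
    , subst (_< ½ * ε) (ℚ.*-zeroʳ ½) (ℚ.*-monoʳ-<-pos ½ p)
    , trans (sym (ℚ.*-distribʳ-+ ε ½ ½)) (ℚ.*-identityˡ ε)

  ∣-∣-swap : ∀ x y → ∣ x - y ∣ ≡ ∣ y - x ∣
  ∣-∣-swap x y = trans (sym (ℚ.∣-p∣≡∣p∣ (x - y))) (cong ∣_∣ (lem x y))
    where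
      open +-*-Solver
      lem : ∀ x y → - (x - y) ≡ y - x
      lem = solve 2 (λ a b → :- (a :- b) := b :- a) refl

  p≤∣p∣ : ∀ p → p ≤ ∣ p ∣
  p≤∣p∣ p with ℚ.≤-total 0ℚ p
  ... | inj₁ 0≤p = ℚ.≤-reflexive (sym (ℚ.0≤p⇒∣p∣≡p 0≤p))
  ... | inj₂ p≤0 = ℚ.≤-trans p≤0 (ℚ.0≤∣p∣ p)

  close⇒< : ∀ x y {ε} → ∣ x - y ∣ < ε → x < y + ε
  close⇒< x y {ε} c = subst (_< y + ε) (lem x y)
      (ℚ.+-monoʳ-< y (ℚ.≤-<-trans (p≤∣p∣ (x - y)) c))
    where
      open +-*-Solver
      lem : ∀ x y → y + (x - y) ≡ x
      lem = solve 2 (λ a b → b :+ (a :- b) := a) refl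

  close⇒<′ : ∀ x y {ε} → ∣ x - y ∣ < ε → y < x + ε
  close⇒<′ x y c = close⇒< y x (subst (_< _) (∣-∣-swap x y) c)

  ∣-∣-triangle : ∀ x y z {δ ε} → ∣ x - y ∣ < δ → ∣ y - z ∣ < ε → ∣ x - z ∣ < δ + ε
  ∣-∣-triangle x y z {δ} {ε} p q = subst (λ t → ∣ t ∣ < δ + ε) (lem x y z)
      (ℚ.≤-<-trans (ℚ.∣p+q∣≤∣p∣+∣q∣ (x - y) (y - z)) (ℚ.+-mono-< p q))
    where
      open +-*-Solver
      lem : ∀ x y z → (x - y) + (y - z) ≡ x - z
      lem = solve 3 (λ x y z → (x :- y) :+ (y :- z) := x :- z) refl

  ≤⊔ˡ : ∀ {m n k} → m ⊔ₙ n ≤ₙ k → m ≤ₙ k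
  ≤⊔ˡ {m} {n} = ℕ.≤-trans (ℕ.m≤m⊔n m n)

  ≤⊔ʳ : ∀ {m n k} → m ⊔ₙ n ≤ₙ k → n ≤ₙ k
  ≤⊔ʳ {m} {n} = ℕ.≤-trans (ℕ.m≤n⊔m m n)

  Eventually : (ℕ → Set) → Set
  Eventually P = ∃ λ N → ∀ n → N ≤ₙ n → P n

  both : ∀ {P Q : ℕ → Set} → Eventually P → Eventually Q → Eventually (λ n → P n × Q n)
  both (M , p) (N , q) = M ⊔ₙ N , λ n h → p n (≤⊔ˡ {M} h) , q n (≤⊔ʳ {M} h)

  mapE : ∀ {P Q : ℕ → Set} → (∀ {n} → P n → Q n) → Eventually P → Eventually Q
  mapE f (N , p) = N , λ n h → f (p n h)

  never : ∀ {P : ℕ → Set} → (∀ {n} → ¬ P n) → ¬ Eventually P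
  never f (N , p) = f (p N ℕ.≤-refl)

  Cauchy : (ℕ → ℚ) → Set
  Cauchy s = ∀ ε → 0ℚ < ε → ∃ λ N → ∀ m n → N ≤ₙ m → N ≤ₙ n → ∣ s m - s n ∣ < ε

  -- No η here and in CompactOpen: conversion checking should not unfold proofs.
  record ℝ : Set where
    no-eta-equality
    field
      seq    : ℕ → ℚ
      cauchy : Cauchy seq
  open ℝ public

  infix 4 _≈ᵣ_ _<ᵣ_ _≤ᵣ_
  infixl 6 _+ᵣ_
  infixl 7 _*ᵣ_

  record _≈ᵣ_ (x y : ℝ) : Set where
    constructor mk≈
    field
      close : ∀ ε → 0ℚ < ε → Eventually λ n → ∣ seq x n - seq y n ∣ < ε
  open _≈ᵣ_ public

  record _<ᵣ_ (x y : ℝ) : Set where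
    constructor mk<
    field
      gap      : ℚ
      gap-pos  : 0ℚ < gap
      gap-left : Eventually λ n → seq x n + gap ≤ seq y n

  _≤ᵣ_ : ℝ → ℝ → Set
  x ≤ᵣ y = ¬ (y <ᵣ x)

  fromℚ : ℚ → ℝ
  fromℚ q .seq _ = q
  fromℚ q .cauchy ε 0<ε = 0 , λ _ _ _ _ → subst (_< ε) (sym (cong ∣_∣ (ℚ.+-inverseʳ q))) 0<ε

  0ᵣ 1ᵣ : ℝ
  0ᵣ = fromℚ 0ℚ
  1ᵣ = fromℚ 1ℚ

  Cauchy₂ : (ℕ → ℚ) → Set
  Cauchy₂ s = ∀ η → 0ℚ < η → ∃ λ N → ∀ m n → N ≤ₙ m → N ≤ₙ n → ∣ s m - s n ∣ < η + η

  cauchy₂⇒cauchy : ∀ s → Cauchy₂ s → Cauchy s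
  cauchy₂⇒cauchy s c ε 0<ε = go (halve 0<ε)
    where
      go : (∃ λ η → 0ℚ < η × η + η ≡ ε) → _
      go (η , 0<η , η+η≡ε) = proj₁ (c η 0<η) , λ m n hm hn →
        subst (∣ s m - s n ∣ <_) η+η≡ε (proj₂ (c η 0<η) m n hm hn)

  sum-close : ∀ a b c d {α β} → ∣ a - c ∣ < α → ∣ b - d ∣ < β → ∣ (a + b) - (c + d) ∣ < α + β
  sum-close a b c d {α} {β} p q = subst (λ t → ∣ t ∣ < α + β) (sym (lem a b c d))
      (ℚ.≤-<-trans (ℚ.∣p+q∣≤∣p∣+∣q∣ (a - c) (b - d)) (ℚ.+-mono-< p q))
    where
      open +-*-Solver
      lem : ∀ a b c d → (a + b) - (c + d) ≡ (a - c) + (b - d)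
      lem = solve 4 (λ a b c d → (a :+ b) :- (c :+ d) := (a :- c) :+ (b :- d)) refl

  _+ᵣ_ : ℝ → ℝ → ℝ
  (x +ᵣ y) .seq n = seq x n + seq y n
  (x +ᵣ y) .cauchy = cauchy₂⇒cauchy (λ n → seq x n + seq y n) λ η 0<η →
      go η (cauchy x η 0<η) (cauchy y η 0<η)
    where
      go : ∀ η → (∃ λ M → ∀ m n → M ≤ₙ m → M ≤ₙ n → ∣ seq x m - seq x n ∣ < η)
               → (∃ λ N → ∀ m n → N ≤ₙ m → N ≤ₙ n → ∣ seq y m - seq y n ∣ < η) → _
      go η (M , p) (N , q) = M ⊔ₙ N , λ m n hm hn →
        sum-close (seq x m) (seq y m) (seq x n) (seq y n)
          (p m n (≤⊔ˡ {M} hm) (≤⊔ˡ {M} hn)) (q m n (≤⊔ʳ {M} hm) (≤⊔ʳ {M} hn))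

  bounded : ∀ x → ∃ λ B → 0ℚ < B × Eventually λ n → ∣ seq x n ∣ ≤ B
  bounded x with cauchy x 1ℚ (ℚ.positive⁻¹ 1ℚ)
  ... | N , p = ∣ seq x N ∣ + 1ℚ
              , ℚ.+-mono-≤-< (ℚ.0≤∣p∣ (seq x N)) (ℚ.positive⁻¹ 1ℚ)
              , N , λ n h → subst (_≤ ∣ seq x N ∣ + 1ℚ) (cong ∣_∣ (lem (seq x N) (seq x n)))
                  (ℚ.≤-trans (ℚ.∣p+q∣≤∣p∣+∣q∣ (seq x N) (seq x n - seq x N))
                    (ℚ.+-monoʳ-≤ ∣ seq x N ∣ (ℚ.<⇒≤ (p n N h ℕ.≤-refl))))
    where
      open +-*-Solver
      lem : ∀ a b → a + (b - a) ≡ b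
      lem = solve 2 (λ a b → a :+ (b :- a) := b) refl

  ClosenessFor : ℚ → ℚ → ℚ → Set
  ClosenessFor B η δ = ∀ a b → ∣ a ∣ ≤ B → ∣ b ∣ < δ → ∣ a * b ∣ < η

  shrink : ∀ B → 0ℚ < B → ∀ η → 0ℚ < η → ∃ λ δ → 0ℚ < δ × ClosenessFor B η δ
  shrink B 0<B η 0<η = δ , 0<δ , bound
    where
      instance
        B-pos : Positive B
        B-pos = ℚ.positive 0<B
        B-nz = ℚ.pos⇒nonZero B
        B⁻¹-pos : Positive (ℚ.1/ B)
        B⁻¹-pos = ℚ.1/pos⇒pos B
      δ = (ℚ.1/ B) * η
      0<δ : 0ℚ < δ
      0<δ = subst (_< δ) (ℚ.*-zeroʳ (ℚ.1/ B)) (ℚ.*-monoʳ-<-pos (ℚ.1/ B) 0<η)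
      Bδ≡η : B * δ ≡ η
      Bδ≡η = trans (sym (ℚ.*-assoc B (ℚ.1/ B) η))
               (trans (cong (_* η) (ℚ.*-inverseʳ B)) (ℚ.*-identityˡ η))
      bound : ClosenessFor B η δ
      bound a b p q = subst₂ _<_ (sym (ℚ.∣p*q∣≡∣p∣*∣q∣ a b)) Bδ≡η
        (ℚ.≤-<-trans (ℚ.*-monoʳ-≤-nonNeg ∣ b ∣ {{ℚ.∣-∣-nonNeg b}} p) (ℚ.*-monoʳ-<-pos B q))

  product-close : ∀ a b c d {A B α β η} → ClosenessFor A η α → ClosenessFor B η β →
                  ∣ a ∣ ≤ A → ∣ d ∣ ≤ B → ∣ b - d ∣ < α → ∣ a - c ∣ < β →
                  ∣ a * b - c * d ∣ < η + η
  product-close a b c d {η = η} f g a≤A d≤B b~d a~c =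
      subst (λ t → ∣ t ∣ < η + η) (sym (lem a b c d))
        (ℚ.≤-<-trans (ℚ.∣p+q∣≤∣p∣+∣q∣ (a * (b - d)) (d * (a - c)))
          (ℚ.+-mono-< (f a (b - d) a≤A b~d) (g d (a - c) d≤B a~c)))
    where
      open +-*-Solver
      lem : ∀ a b c d → a * b - c * d ≡ a * (b - d) + d * (a - c)
      lem = solve 4 (λ a b c d → a :* b :- c :* d := a :* (b :- d) :+ d :* (a :- c)) refl

  _*ᵣ_ : ℝ → ℝ → ℝ
  (x *ᵣ y) .seq n = seq x n * seq y n
  (x *ᵣ y) .cauchy = cauchy₂⇒cauchy (λ n → seq x n * seq y n) λ η 0<η →
      go₁ η 0<η (bounded x) (bounded y)
    where
      Goal : ℚ → Set
      Goal η = ∃ λ N → ∀ m n → N ≤ₙ m → N ≤ₙ n →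
        ∣ seq x m * seq y m - seq x n * seq y n ∣ < η + η
      Bound : ℝ → ℚ → Set
      Bound z B = Eventually λ n → ∣ seq z n ∣ ≤ B
      Within : ℝ → ℚ → Set
      Within z ε = ∃ λ N → ∀ m n → N ≤ₙ m → N ≤ₙ n → ∣ seq z m - seq z n ∣ < ε
      go₃ : ∀ {A B α β η} → ClosenessFor A η α → ClosenessFor B η β →
            Bound x A → Bound y B → Within y α → Within x β → Goal η
      go₃ f g (K , a) (L , b) (M , p) (N , q) = (K ⊔ₙ L) ⊔ₙ (M ⊔ₙ N) , λ m n hm hn →
        product-close (seq x m) (seq y m) (seq x n) (seq y n) f g
          (a m (≤⊔ˡ {K} (≤⊔ˡ {K ⊔ₙ L} hm)))
          (b n (≤⊔ʳ {K} (≤⊔ˡ {K ⊔ₙ L} hn)))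
          (p m n (≤⊔ˡ {M} (≤⊔ʳ {K ⊔ₙ L} hm)) (≤⊔ˡ {M} (≤⊔ʳ {K ⊔ₙ L} hn)))
          (q m n (≤⊔ʳ {M} (≤⊔ʳ {K ⊔ₙ L} hm)) (≤⊔ʳ {M} (≤⊔ʳ {K ⊔ₙ L} hn)))
      go₂ : ∀ {A B η} → Bound x A → Bound y B →
            (∃ λ α → 0ℚ < α × ClosenessFor A η α) → (∃ λ β → 0ℚ < β × ClosenessFor B η β) → Goal η
      go₂ a b (α , 0<α , f) (β , 0<β , g) = go₃ f g a b (cauchy y α 0<α) (cauchy x β 0<β)
      go₁ : ∀ η → 0ℚ < η → (∃ λ A → 0ℚ < A × Bound x A) → (∃ λ B → 0ℚ < B × Bound y B) → Goal η
      go₁ η 0<η (A , 0<A , a) (B , 0<B , b) = go₂ a b (shrink A 0<A η 0<η) (shrink B 0<B η 0<η)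

  <ᵣ-irrefl : ∀ {x} → ¬ (x <ᵣ x)
  <ᵣ-irrefl {x} (mk< ε 0<ε (N , p)) = ℚ.<-irrefl refl
    (ℚ.<-≤-trans (subst (_< seq x N + ε) (ℚ.+-identityʳ _) (ℚ.+-monoʳ-< (seq x N) 0<ε)) (p N ℕ.≤-refl))

  <ᵣ-trans : ∀ {x y z} → x <ᵣ y → y <ᵣ z → x <ᵣ z
  <ᵣ-trans {x} {y} {z} (mk< ε 0<ε p) (mk< η 0<η q) = mk< ε 0<ε
    (mapE (λ {n} (a , b) → ℚ.≤-trans a (ℚ.≤-trans
      (subst (_≤ seq y n + η) (ℚ.+-identityʳ _) (ℚ.+-monoʳ-≤ (seq y n) (ℚ.<⇒≤ 0<η))) b)) (both p q))

  ≈ᵣ-sym : ∀ {x y} → x ≈ᵣ y → y ≈ᵣ x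
  ≈ᵣ-sym {x} {y} e = mk≈ λ ε 0<ε →
    mapE (λ {n} → subst (_< ε) (∣-∣-swap (seq x n) (seq y n))) (close e ε 0<ε)

  ≈ᵣ-trans : ∀ {x y z} → x ≈ᵣ y → y ≈ᵣ z → x ≈ᵣ z
  ≈ᵣ-trans {x} {y} {z} e f = mk≈ λ ε 0<ε → go ε (halve 0<ε)
    where
      go : ∀ ε → (∃ λ η → 0ℚ < η × η + η ≡ ε) → Eventually λ n → ∣ seq x n - seq z n ∣ < ε
      go ε (η , 0<η , e′) = mapE (λ {n} (a , b) → subst (∣ seq x n - seq z n ∣ <_) e′
        (∣-∣-triangle (seq x n) (seq y n) (seq z n) a b)) (both (close e η 0<η) (close f η 0<η))

  0ᵣ≤1ᵣ : 0ᵣ ≤ᵣ 1ᵣ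
  0ᵣ≤1ᵣ (mk< ε 0<ε (N , p)) = ℚ.<-irrefl refl (ℚ.<-≤-trans
    (ℚ.+-mono-< (ℚ.positive⁻¹ 1ℚ) 0<ε) (p N ℕ.≤-refl))

  0≤⇒≤ : ∀ {x y a b} → a ≤ b → y - x ≡ b - a → x ≤ y
  0≤⇒≤ {x} {y} {a} {b} p e = subst₂ _≤_ (lem a x)
      (trans (lem′ a b x) (trans (cong (λ d → x + d) (sym e)) (lem x y)))
      (ℚ.+-monoˡ-≤ (x - a) p)
    where
      open +-*-Solver
      lem : ∀ a x → a + (x - a) ≡ x
      lem = solve 2 (λ a x → a :+ (x :- a) := x) refl
      lem′ : ∀ a b x → b + (x - a) ≡ x + (b - a)
      lem′ = solve 3 (λ a b x → b :+ (x :- a) := x :+ (b :- a)) refl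

  absorb : ∀ x y z η → x + (η + η) ≤ y → y ≤ z + η → x + η ≤ z
  absorb x y z η p q = 0≤⇒≤ (ℚ.≤-trans p q) (lem x z η)
    where
      open +-*-Solver
      lem : ∀ x z η → z - (x + η) ≡ (z + η) - (x + (η + η))
      lem = solve 3 (λ x z η → z :- (x :+ η) := (z :+ η) :- (x :+ (η :+ η))) refl

  respˡ-step : ∀ x y z η → x + (η + η) ≤ z → ∣ x - y ∣ < η → y + η ≤ z
  respˡ-step x y z η p q = ℚ.≤-trans (ℚ.+-monoˡ-≤ η (ℚ.<⇒≤ (close⇒<′ x y q)))
    (subst (_≤ z) (sym (ℚ.+-assoc x η η)) p)

  <ᵣ-respʳ : ∀ {x y z} → y ≈ᵣ z → x <ᵣ y → x <ᵣ z
  <ᵣ-respʳ {x} {y} {z} e (mk< ε 0<ε p) = go (halve 0<ε)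
    where
      go : (∃ λ η → 0ℚ < η × η + η ≡ ε) → x <ᵣ z
      go (η , 0<η , refl) = mk< η 0<η
        (mapE (λ {n} (a , b) → absorb (seq x n) (seq y n) (seq z n) η a
          (ℚ.<⇒≤ (close⇒< (seq y n) (seq z n) b))) (both p (close e η 0<η)))

  <ᵣ-respˡ : ∀ {x y z} → x ≈ᵣ y → x <ᵣ z → y <ᵣ z
  <ᵣ-respˡ {x} {y} {z} e (mk< ε 0<ε p) = go (halve 0<ε)
    where
      go : (∃ λ η → 0ℚ < η × η + η ≡ ε) → y <ᵣ z
      go (η , 0<η , refl) = mk< η 0<η
        (mapE (λ {n} (a , b) → respˡ-step (seq x n) (seq y n) (seq z n) η a b) (both p (close e η 0<η)))

  upper-step : ∀ x y x₀ y₀ g a → x₀ ≤ y₀ + (g + (a + a)) → ∣ x - x₀ ∣ < a → ∣ y - y₀ ∣ < a →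
               x ≤ y + (g + (a + a) + (a + a))
  upper-step x y x₀ y₀ g a h p q = subst (x ≤_) (lem y g a)
      (ℚ.≤-trans (ℚ.<⇒≤ (close⇒< x x₀ p))
        (ℚ.+-monoˡ-≤ a (ℚ.≤-trans h (ℚ.+-monoˡ-≤ (g + (a + a)) (ℚ.<⇒≤ (close⇒<′ y y₀ q))))))
    where
      open +-*-Solver
      lem : ∀ y g a → (y + a) + (g + (a + a)) + a ≡ y + (g + (a + a) + (a + a))
      lem = solve 3 (λ y g a → (y :+ a) :+ (g :+ (a :+ a)) :+ a
                  := y :+ (g :+ (a :+ a) :+ (a :+ a))) refl

  gap-step : ∀ x y x₀ y₀ g a → y₀ + (g + (a + a)) ≤ x₀ → ∣ x - x₀ ∣ < a → ∣ y - y₀ ∣ < a →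
             y + g ≤ x
  gap-step x y x₀ y₀ g a h p q = 0≤⇒≤
      (ℚ.≤-trans (ℚ.+-monoˡ-≤ (g + (a + a)) (ℚ.<⇒≤ (close⇒< y y₀ q)))
        (ℚ.≤-trans (ℚ.≤-reflexive (lem₁ y₀ g a))
          (ℚ.+-monoˡ-≤ a (ℚ.≤-trans h (ℚ.<⇒≤ (close⇒<′ x x₀ p))))))
      (lem₂ x y g a)
    where
      open +-*-Solver
      lem₁ : ∀ y g a → (y + a) + (g + (a + a)) ≡ (y + (g + (a + a))) + a
      lem₁ = solve 3 (λ y g a → (y :+ a) :+ (g :+ (a :+ a)) := (y :+ (g :+ (a :+ a))) :+ a) refl
      lem₂ : ∀ x y g a → x - (y + g) ≡ ((x + a) + a) - (y + (g + (a + a)))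
      lem₂ = solve 4 (λ x y g a → x :- (y :+ g) := ((x :+ a) :+ a) :- (y :+ (g :+ (a :+ a)))) refl

  ≤ᵣ⇒eventually : ∀ {x y} → x ≤ᵣ y → ∀ δ → 0ℚ < δ → Eventually λ n → seq x n ≤ seq y n + δ
  ≤ᵣ⇒eventually {x} {y} x≤y δ 0<δ = go₁ (halve 0<δ)
    where
      Goal : Set
      Goal = Eventually λ n → seq x n ≤ seq y n + δ
      Within : ℝ → ℚ → Set
      Within z a = ∃ λ N → ∀ m n → N ≤ₙ m → N ≤ₙ n → ∣ seq z m - seq z n ∣ < a
      go₄ : ∀ g a → 0ℚ < g → g + (a + a) + (a + a) ≡ δ → ∀ N →
            (∀ n → N ≤ₙ n → ∣ seq x n - seq x N ∣ < a × ∣ seq y n - seq y N ∣ < a) →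
            (seq x N ≤ seq y N + (g + (a + a))) ⊎ (seq y N + (g + (a + a)) ≤ seq x N) → Goal
      go₄ g a 0<g e N p (inj₁ h) = N , λ n k → subst (λ d → seq x n ≤ seq y n + d) e
        (upper-step (seq x n) (seq y n) (seq x N) (seq y N) g a h (proj₁ (p n k)) (proj₂ (p n k)))
      go₄ g a 0<g e N p (inj₂ h) = contradiction (mk< g 0<g (N , λ n k →
        gap-step (seq x n) (seq y n) (seq x N) (seq y N) g a h (proj₁ (p n k)) (proj₂ (p n k)))) x≤y
      go₃ : ∀ g a → 0ℚ < g → g + (a + a) + (a + a) ≡ δ → Within x a → Within y a → Goal
      go₃ g a 0<g e (M , p) (N , q) = go₄ g a 0<g e (M ⊔ₙ N)
        (λ n k → p n (M ⊔ₙ N) (≤⊔ˡ {M} k) (ℕ.m≤m⊔n M N) , q n (M ⊔ₙ N) (≤⊔ʳ {M} k) (ℕ.m≤n⊔m M N))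
        (ℚ.≤-total _ _)
      go₂ : ∀ g η a → 0ℚ < g → g + g ≡ δ → η + η ≡ g → 0ℚ < a → a + a ≡ η → Goal
      go₂ g η a 0<g g+g≡δ η+η≡g 0<a refl = go₃ g a 0<g
        (trans (ℚ.+-assoc g (a + a) (a + a)) (trans (cong (g +_) η+η≡g) g+g≡δ))
        (cauchy x a 0<a) (cauchy y a 0<a)
      go₁ : (∃ λ g → 0ℚ < g × g + g ≡ δ) → Goal
      go₁ (g , 0<g , e) = let (η , 0<η , e′) = halve 0<g ; (a , 0<a , e″) = halve 0<η in
        go₂ g η a 0<g e e′ 0<a e″

  <ᵣ-≤ᵣ-trans : ∀ {x y z} → x <ᵣ y → y ≤ᵣ z → x <ᵣ z
  <ᵣ-≤ᵣ-trans {x} {y} {z} (mk< ε 0<ε p) y≤z = go (halve 0<ε)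
    where
      go : (∃ λ η → 0ℚ < η × η + η ≡ ε) → x <ᵣ z
      go (η , 0<η , refl) = mk< η 0<η
        (mapE (λ {n} (a , b) → absorb (seq x n) (seq y n) (seq z n) η a b)
          (both p (≤ᵣ⇒eventually y≤z η 0<η)))

  x<x² : ∀ {x} → 1ᵣ <ᵣ x → x <ᵣ x *ᵣ x
  x<x² {x} (mk< ε 0<ε p) = mk< ε 0<ε (mapE (λ {n} h → step (seq x n) h) p)
    where
      open +-*-Solver
      instance
        _ : NonNegative ε
        _ = ℚ.nonNegative (ℚ.<⇒≤ 0<ε)
      lem : ∀ a ε → (a * a) - (a + ε) ≡ (a * a + ε * a) - ((a + ε * a) + ε)
      lem = solve 2 (λ a ε → (a :* a) :- (a :+ ε)
          := (a :* a :+ ε :* a) :- ((a :+ ε :* a) :+ ε)) refl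
      step : ∀ a → 1ℚ + ε ≤ a → a + ε ≤ a * a
      step a h = 0≤⇒≤
          (ℚ.+-mono-≤
            (subst (_≤ a * a) (trans (ℚ.*-distribʳ-+ a 1ℚ ε) (cong (_+ ε * a) (ℚ.*-identityˡ a)))
              (ℚ.*-monoʳ-≤-nonNeg a {{ℚ.nonNegative 0≤a}} h))
            (subst (_≤ ε * a) (ℚ.*-identityʳ ε) (ℚ.*-monoˡ-≤-nonNeg ε 1≤a)))
          (lem a ε)
        where
          1≤a : 1ℚ ≤ a
          1≤a = ℚ.≤-trans (subst (_≤ 1ℚ + ε) (ℚ.+-identityʳ 1ℚ) (ℚ.+-monoʳ-≤ 1ℚ (ℚ.<⇒≤ 0<ε))) h
          0≤a : 0ℚ ≤ a
          0≤a = ℚ.≤-trans (ℚ.nonNegative⁻¹ 1ℚ) 1≤a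

  x²≈x⇒x≤1 : ∀ {x} → x *ᵣ x ≈ᵣ x → x ≤ᵣ 1ᵣ
  x²≈x⇒x≤1 {x} e 1<x = <ᵣ-irrefl {x} (<ᵣ-respʳ {x} {x *ᵣ x} {x} e (x<x² {x} 1<x))

  x²≈y⇒x≤1 : ∀ {x y} → x *ᵣ x ≈ᵣ y → y ≤ᵣ 1ᵣ → x ≤ᵣ 1ᵣ
  x²≈y⇒x≤1 {x} {y} e y≤1 1<x =
    y≤1 (<ᵣ-trans {1ᵣ} {x} {y} 1<x (<ᵣ-respʳ {x} {x *ᵣ x} {y} e (x<x² {x} 1<x)))

  1≮xy : ∀ {x y} → 0ᵣ ≤ᵣ x → x ≤ᵣ 1ᵣ → 0ᵣ ≤ᵣ y → y ≤ᵣ 1ᵣ → ∀ ε/4 → 0ℚ < ε/4 →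
         ¬ Eventually λ n → 1ℚ + (ε/4 + ε/4 + (ε/4 + ε/4)) ≤ seq x n * seq y n
  1≮xy {x} {y} 0≤x x≤1 0≤y y≤1 ε/4 0<ε/4 p =
    never (λ {n} → absurd {n})
        (both p (both (both (≤ᵣ⇒eventually 0≤x δ 0<δ) (≤ᵣ⇒eventually x≤1 δ 0<δ))
                      (both (≤ᵣ⇒eventually 0≤y δ 0<δ) (≤ᵣ⇒eventually y≤1 δ 0<δ))))
    where
      δ = ε/4 ℚ.⊓ 1ℚ
      0<δ : 0ℚ < δ
      0<δ with ℚ.⊓-sel ε/4 1ℚ
      ... | inj₁ e = subst (0ℚ <_) (sym e) 0<ε/4
      ... | inj₂ e = subst (0ℚ <_) (sym e) (ℚ.positive⁻¹ 1ℚ)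
      0≤1+δ : 0ℚ ≤ 1ℚ + δ
      0≤1+δ = ℚ.+-mono-≤ (ℚ.nonNegative⁻¹ 1ℚ) (ℚ.<⇒≤ 0<δ)
      δ≤1+δ : δ ≤ 1ℚ + δ
      δ≤1+δ = subst (_≤ 1ℚ + δ) (ℚ.+-identityˡ δ) (ℚ.+-monoˡ-≤ δ (ℚ.nonNegative⁻¹ 1ℚ))
      neg≤ : ∀ a d → 0ℚ ≤ a + d → - a ≤ d
      neg≤ a d h = 0≤⇒≤ h (lem a d)
        where
          open +-*-Solver
          lem : ∀ a d → d - (- a) ≡ (a + d) - 0ℚ
          lem a d = trans (solve 2 (λ a d → d :- (:- a) := a :+ d) refl a d) (sym (ℚ.+-identityʳ (a + d)))
      abs : ∀ a → 0ℚ ≤ a + δ → a ≤ 1ℚ + δ → ∣ a ∣ ≤ 1ℚ + δ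
      abs a h k with ℚ.∣p∣≡p∨∣p∣≡-p a
      ... | inj₁ e = subst (_≤ 1ℚ + δ) (sym e) k
      ... | inj₂ e = subst (_≤ 1ℚ + δ) (sym e) (ℚ.≤-trans (neg≤ a δ h) δ≤1+δ)
      instance
        _ : NonNegative (1ℚ + δ)
        _ = ℚ.nonNegative 0≤1+δ
        _ : NonNegative δ
        _ = ℚ.nonNegative (ℚ.<⇒≤ 0<δ)
      δ≤ : δ ≤ ε/4
      δ≤ = ℚ.p⊓q≤p ε/4 1ℚ
      expand : ∀ d → (1ℚ + d) * (1ℚ + d) ≡ 1ℚ + ((d + d) + d * d)
      expand d = trans (ℚ.*-distribʳ-+ (1ℚ + d) 1ℚ d)
        (trans (cong₂ _+_ (ℚ.*-identityˡ (1ℚ + d))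
                 (trans (ℚ.*-distribˡ-+ d 1ℚ d) (cong (_+ d * d) (ℚ.*-identityʳ d))))
          (lem 1ℚ d (d * d)))
        where
          open +-*-Solver
          lem : ∀ u d e → (u + d) + (d + e) ≡ u + ((d + d) + e)
          lem = solve 3 (λ u d e → (u :+ d) :+ (d :+ e) := u :+ ((d :+ d) :+ e)) refl
      δ²≤ : δ * δ ≤ ε/4
      δ²≤ = ℚ.≤-trans (ℚ.*-monoˡ-≤-nonNeg δ (ℚ.p⊓q≤q ε/4 1ℚ))
              (subst (_≤ ε/4) (sym (ℚ.*-identityʳ δ)) δ≤)
      small : (1ℚ + δ) * (1ℚ + δ) < 1ℚ + (ε/4 + ε/4 + (ε/4 + ε/4))
      small = subst (_< 1ℚ + (ε/4 + ε/4 + (ε/4 + ε/4))) (sym (expand δ))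
        (ℚ.+-monoʳ-< 1ℚ (ℚ.≤-<-trans (ℚ.+-mono-≤ (ℚ.+-mono-≤ δ≤ δ≤) δ²≤)
          (ℚ.+-monoʳ-< (ε/4 + ε/4) (subst (_< ε/4 + ε/4) (ℚ.+-identityʳ ε/4) (ℚ.+-monoʳ-< ε/4 0<ε/4)))))
      absurd : ∀ {n} → ¬ (1ℚ + (ε/4 + ε/4 + (ε/4 + ε/4)) ≤ seq x n * seq y n ×
                 ((0ℚ ≤ seq x n + δ × seq x n ≤ 1ℚ + δ) × (0ℚ ≤ seq y n + δ × seq y n ≤ 1ℚ + δ)))
      absurd {n} (h , (a , b) , (c , d)) = ℚ.<-irrefl refl (ℚ.<-≤-trans small (ℚ.≤-trans h
        (ℚ.≤-trans (p≤∣p∣ (seq x n * seq y n))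
          (subst (_≤ (1ℚ + δ) * (1ℚ + δ)) (sym (ℚ.∣p*q∣≡∣p∣*∣q∣ (seq x n) (seq y n)))
            (ℚ.≤-trans (ℚ.*-monoʳ-≤-nonNeg ∣ seq y n ∣ {{ℚ.∣-∣-nonNeg (seq y n)}} (abs (seq x n) a b))
                       (ℚ.*-monoˡ-≤-nonNeg (1ℚ + δ) (abs (seq y n) c d)))))))

  x*y≤1 : ∀ {x y} → 0ᵣ ≤ᵣ x → x ≤ᵣ 1ᵣ → 0ᵣ ≤ᵣ y → y ≤ᵣ 1ᵣ → x *ᵣ y ≤ᵣ 1ᵣ
  x*y≤1 {x} {y} 0≤x x≤1 0≤y y≤1 (mk< ε 0<ε p) =
    let (ε/2 , 0<ε/2 , e) = halve 0<ε ; (ε/4 , 0<ε/4 , e′) = halve 0<ε/2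
    in 1≮xy 0≤x x≤1 0≤y y≤1 ε/4 0<ε/4
         (mapE (λ {n} → subst (λ d → 1ℚ + d ≤ seq x n * seq y n) (sym (trans (cong₂ _+_ e′ e′) e))) p)

  ≤ᵣ-respˡ : ∀ {x y z} → x ≈ᵣ y → y ≤ᵣ z → x ≤ᵣ z
  ≤ᵣ-respˡ {x} {y} {z} e y≤z z<x = y≤z (<ᵣ-respʳ {z} {x} {y} e z<x)

open Reals public

-- Evaluation of the polynomial with coefficients c₀ ∷ c₁ ∷ … (constant term first).
module _ (R : CommutativeRing 0ℓ 0ℓ) where
  open CommutativeRing R

  eval : List Carrier → Carrier → Carrier
  eval []       x = 0#
  eval (c ∷ cs) x = c + x * eval cs x

record IsDomain (R : CommutativeRing 0ℓ 0ℓ) : Set where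
  open CommutativeRing R
  field
    1≉0       : ¬ (1# ≈ 0#)
    *-nonzero : ∀ {x y} → ¬ (x ≈ 0#) → ¬ (y ≈ 0#) → ¬ (x * y ≈ 0#)

module GlobalField (F : HeytingField 0ℓ 0ℓ 0ℓ) where
  open HeytingField F using (heytingCommutativeRing; tight)
  open HeytingCommutativeRing heytingCommutativeRing using () renaming (commutativeRing to F-ring) public
  open CommutativeRing F-ring
  open RawMonoidOps +-rawMonoid using (sum) renaming (_×_ to _·ℕ_)

  -- For a subfield K ⊆ F: the K-vector space F is finite-dimensional.
  FiniteOver : Pred Carrier 0ℓ → Set
  FiniteOver K = ∃ λ n → ∃ λ (b : Fin n → Carrier) → ∀ x →
    ∃ λ (c : Fin n → Carrier) → (∀ i → c i ∈ K) × x ≈ sum (λ i → c i * b i)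

  IsNumberField : Set
  IsNumberField = ∃ λ (ι : ℚ → Carrier) →
    IsRingHomomorphism (CommutativeRing.rawRing ℚ.+-*-commutativeRing) rawRing ι ×
    FiniteOver (λ x → ∃ λ q → x ≈ ι q)

  -- For F of characteristic p.  Elements of the prime field 𝔽ₚ ⊆ F are
  -- represented by Fin p, and 𝔽ₚ⟨ t ⟩ is the subfield generated by t.
  module _ (p : ℕ) where

    evalₚ : List (Fin p) → Carrier → Carrier
    evalₚ P = eval F-ring (map (λ c → toℕ c ·ℕ 1#) P)

    Transcendentalₚ : Pred Carrier 0ℓ
    Transcendentalₚ t = ∀ P → evalₚ P t ≈ 0# → All (λ c → toℕ c ≡ 0) P

    𝔽ₚ⟨_⟩ : Carrier → Pred Carrier 0ℓ
    𝔽ₚ⟨ t ⟩ x = ∃ λ P → ∃ λ Q → ¬ (evalₚ Q t ≈ 0#) × evalₚ Q t * x ≈ evalₚ P t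

  -- F is a finite extension of a rational function field 𝔽ₚ(t).
  IsFunctionField : Set
  IsFunctionField = ∃ λ p → Prime p × p ·ℕ 1# ≈ 0# ×
    ∃ λ t → Transcendentalₚ p t × FiniteOver (𝔽ₚ⟨_⟩ p t)

  IsGlobalField : Set
  IsGlobalField = IsNumberField ⊎ IsFunctionField

  -- A nontrivial absolute value.  Places are the classes of these under _∼_, so
  -- everything said of places below is invariant under _∼_.
  record Place : Set where
    field
      ∣_∣            : Carrier → ℝ
      cong           : ∀ {x y} → x ≈ y → ∣ x ∣ ≈ᵣ ∣ y ∣
      nonneg         : ∀ x → 0ᵣ ≤ᵣ ∣ x ∣
      ∣0∣≈0          : ∣ 0# ∣ ≈ᵣ 0ᵣ
      definite       : ∀ x → ∣ x ∣ ≈ᵣ 0ᵣ → x ≈ 0#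
      multiplicative : ∀ x y → ∣ x * y ∣ ≈ᵣ ∣ x ∣ *ᵣ ∣ y ∣
      triangle       : ∀ x y → ∣ x + y ∣ ≤ᵣ ∣ x ∣ +ᵣ ∣ y ∣
      nontrivial     : ∃ λ x → ¬ (x ≈ 0#) × ¬ (∣ x ∣ ≈ᵣ 1ᵣ)

  open Place

  _∼_ : Rel Place 0ℓ
  v ∼ w = ∀ x → (∣ v ∣ x <ᵣ 1ᵣ) ⇔ (∣ w ∣ x <ᵣ 1ᵣ)

  -- The disjunction is ∣ x + y ∣ ≤ max ∣ x ∣ ∣ y ∣.
  NonArchimedean : Pred Place 0ℓ
  NonArchimedean v = ∀ x y → ∣ v ∣ (x + y) ≤ᵣ ∣ v ∣ x ⊎ ∣ v ∣ (x + y) ≤ᵣ ∣ v ∣ y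

  Archimedean : Pred Place 0ℓ
  Archimedean v = ¬ NonArchimedean v

  _∈ₚ_ : Place → List Place → Set
  v ∈ₚ S = Any (v ∼_) S

  ContainsArchimedean : List Place → Set
  ContainsArchimedean S = ∀ v → Archimedean v → v ∈ₚ S

  IsSInteger : List Place → Pred Carrier 0ℓ
  IsSInteger S x = ∀ v → ¬ (v ∈ₚ S) → ∣ v ∣ x ≤ᵣ 1ᵣ

  F-1≉0 : ¬ (1# ≈ 0#)
  F-1≉0 1≈0 = HeytingCommutativeRing.#-irrefl heytingCommutativeRing 1≈0
    (HeytingProperties.1#0 heytingCommutativeRing)

  F-*-nonzero : ∀ {x y} → ¬ (x ≈ 0#) → ¬ (y ≈ 0#) → ¬ (x * y ≈ 0#)
  F-*-nonzero x≉0 y≉0 xy≈0 = x≉0 (proj₁ (tight _ _) λ x#0 → y≉0 (proj₁ (tight _ _) λ y#0 →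
    HeytingCommutativeRing.#-irrefl heytingCommutativeRing xy≈0
      (HeytingProperties.x#0y#0→xy#0 heytingCommutativeRing x#0 y#0)))

  -1*-1≈1 : - 1# * - 1# ≈ 1#
  -1*-1≈1 = trans (RingProperties.-1*x≈-x ring (- 1#))
                  (AbelianGroupProperties.⁻¹-involutive +-abelianGroup 1#)

  module _ (v : Place) where
    ∣1∣≤1 : ∣ v ∣ 1# ≤ᵣ 1ᵣ
    ∣1∣≤1 = x²≈x⇒x≤1 {∣ v ∣ 1#} (≈ᵣ-trans {∣ v ∣ 1# *ᵣ ∣ v ∣ 1#} {∣ v ∣ (1# * 1#)} {∣ v ∣ 1#}
      (≈ᵣ-sym {∣ v ∣ (1# * 1#)} {∣ v ∣ 1# *ᵣ ∣ v ∣ 1#} (multiplicative v 1# 1#)) (cong v (*-identityˡ 1#)))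

    ∣-1∣≤1 : ∣ v ∣ (- 1#) ≤ᵣ 1ᵣ
    ∣-1∣≤1 = x²≈y⇒x≤1 {∣ v ∣ (- 1#)} {∣ v ∣ 1#}
      (≈ᵣ-trans {∣ v ∣ (- 1#) *ᵣ ∣ v ∣ (- 1#)} {∣ v ∣ (- 1# * - 1#)} {∣ v ∣ 1#}
        (≈ᵣ-sym {∣ v ∣ (- 1# * - 1#)} {∣ v ∣ (- 1#) *ᵣ ∣ v ∣ (- 1#)} (multiplicative v (- 1#) (- 1#)))
        (cong v -1*-1≈1))
      ∣1∣≤1

    ∣0∣≤1 : ∣ v ∣ 0# ≤ᵣ 1ᵣ
    ∣0∣≤1 = ≤ᵣ-respˡ {∣ v ∣ 0#} {0ᵣ} {1ᵣ} (∣0∣≈0 v) 0ᵣ≤1ᵣ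

    ∣*∣≤1 : ∀ {x y} → ∣ v ∣ x ≤ᵣ 1ᵣ → ∣ v ∣ y ≤ᵣ 1ᵣ → ∣ v ∣ (x * y) ≤ᵣ 1ᵣ
    ∣*∣≤1 {x} {y} p q = ≤ᵣ-respˡ {∣ v ∣ (x * y)} {∣ v ∣ x *ᵣ ∣ v ∣ y} {1ᵣ} (multiplicative v x y)
      (x*y≤1 {∣ v ∣ x} {∣ v ∣ y} (nonneg v x) p (nonneg v y) q)

    ∣+∣≤1 : NonArchimedean v → ∀ {x y} → ∣ v ∣ x ≤ᵣ 1ᵣ → ∣ v ∣ y ≤ᵣ 1ᵣ → ∣ v ∣ (x + y) ≤ᵣ 1ᵣ
    ∣+∣≤1 na {x} {y} p q 1<∣x+y∣ with na x y
    ... | inj₁ h = p (<ᵣ-≤ᵣ-trans {1ᵣ} {∣ v ∣ (x + y)} {∣ v ∣ x} 1<∣x+y∣ h)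
    ... | inj₂ h = q (<ᵣ-≤ᵣ-trans {1ᵣ} {∣ v ∣ (x + y)} {∣ v ∣ y} 1<∣x+y∣ h)

  module _ (S : List Place) (arch : ContainsArchimedean S) where
    private
      SInteger : Set
      SInteger = Σ Carrier (IsSInteger S)

      -1∈ : IsSInteger S (- 1#)
      -1∈ v v∉S = ∣-1∣≤1 v

      +-closed : ∀ {x y} → IsSInteger S x → IsSInteger S y → IsSInteger S (x + y)
      +-closed x∈ y∈ v v∉S 1<∣x+y∣ = v∉S (arch v λ na → ∣+∣≤1 v na (x∈ v v∉S) (y∈ v v∉S) 1<∣x+y∣)

      *-closed : ∀ {x y} → IsSInteger S x → IsSInteger S y → IsSInteger S (x * y)
      *-closed x∈ y∈ v v∉S = ∣*∣≤1 v (x∈ v v∉S) (y∈ v v∉S)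

      -‿closed : ∀ {x} → IsSInteger S x → IsSInteger S (- x)
      -‿closed {x} x∈ v v∉S = ≤ᵣ-respˡ (cong v (sym (RingProperties.-1*x≈-x ring x)))
        (*-closed -1∈ x∈ v v∉S)

      SIntegers-rawRing : RawRing 0ℓ 0ℓ
      SIntegers-rawRing = record
        { Carrier = SInteger
        ; _≈_     = λ x y → proj₁ x ≈ proj₁ y
        ; _+_     = λ x y → proj₁ x + proj₁ y , +-closed (proj₂ x) (proj₂ y)
        ; _*_     = λ x y → proj₁ x * proj₁ y , *-closed (proj₂ x) (proj₂ y)
        ; -_      = λ x → - proj₁ x , -‿closed (proj₂ x)
        ; 0#      = 0# , λ v v∉S → ∣0∣≤1 v
        ; 1#      = 1# , λ v v∉S → ∣1∣≤1 v
        }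

      inclusion : IsRingMonomorphism SIntegers-rawRing rawRing proj₁
      inclusion = record
        { isRingHomomorphism = record
          { isSemiringHomomorphism = record
            { isNearSemiringHomomorphism = record
              { +-isMonoidHomomorphism = record
                { isMagmaHomomorphism = record
                  { isRelHomomorphism = record { cong = λ e → e }
                  ; homo = λ _ _ → refl }
                ; ε-homo = refl }
              ; *-homo = λ _ _ → refl }
            ; 1#-homo = refl }
          ; -‿homo = λ _ → refl }
        ; injective = λ e → e }

    SIntegers : CommutativeRing 0ℓ 0ℓ
    SIntegers = record
      { isCommutativeRing = RingMonomorphism.isCommutativeRing inclusion isCommutativeRing }

    SIntegers-isDomain : IsDomain SIntegers
    SIntegers-isDomain = record { 1≉0 = F-1≉0 ; *-nonzero = F-*-nonzero }

-- A topological space (in fact a uniform one), presented by a family of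
-- equivalence relations: the balls { y | near s x y } are a neighbourhood base
-- of x.  Subsets need not respect the induced equality of points; one that does
-- not is to be read as its saturation, which changes none of the notions below.
record Space (j : Level) : Set (lsuc j) where
  field
    Point : Set j
    Scale : Set j
    near  : Scale → Rel Point 0ℓ

  _≈ₛ_ : Rel Point j
  x ≈ₛ y = ∀ s → near s x y

  Open : ∀ {ℓ} → Pred (Pred Point ℓ) (j ⊔ ℓ)
  Open V = ∀ x → x ∈ V → ∃ λ s → ∀ y → near s x y → y ∈ V

  Closure : ∀ {ℓ} → Pred Point ℓ → Pred Point (j ⊔ ℓ)
  Closure X x = ∀ s → ∃ λ y → y ∈ X × near s x y

  Compact : Pred (Pred Point j) (lsuc j)
  Compact K = ∀ {I : Set j} (V : I → Pred Point j) → (∀ i → Open (V i)) →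
    K ⊆ (λ x → ∃ λ i → x ∈ V i) → ∃ λ (is : List I) → K ⊆ (λ x → Any (λ i → x ∈ V i) is)

_^ₛ_ : ∀ {j} → Space j → ℕ → Space j
T ^ₛ k = record
  { Point = Fin k → Space.Point T
  ; Scale = Fin k → Space.Scale T
  ; near  = λ s x y → ∀ i → Space.near T (s i) (x i) (y i) }

-- The image of P ⊆ A in the quotient by the equality of the setoid A has
-- exactly n elements.
HasCard : ∀ {a ℓ p} (A : Setoid a ℓ) → Pred (Setoid.Carrier A) p → ℕ → Set (a ⊔ ℓ ⊔ p)
HasCard A P n = Bijection (≡.setoid (Fin n)) (On.setoid {B = Σ (Setoid.Carrier A) P} A proj₁)

-- Quotient of naturals, with the convention m / 0 = 0.
_÷_ : ℕ → ℕ → ℚ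
m ÷ zero  = 0ℚ
m ÷ suc n = (ℤ.+ m) ℚ./ suc n

-- Excluded middle (for types of every level, hence also in the role of choice)
-- is a parameter because the theory is classical: it decides membership in
-- arbitrary sets and whether a set is finite.
module Procounting
  (lem : ∀ ℓ → ExcludedMiddle ℓ)
  (R : CommutativeRing 0ℓ 0ℓ)
  (isDomain : IsDomain R)
  where

  open CommutativeRing R
  open IsDomain isDomain

  record Ideal : Set₁ where
    field
      member   : Pred Carrier 0ℓ
      resp     : ∀ {x y} → x ≈ y → x ∈ member → y ∈ member
      0-member : 0# ∈ member
      +-closed : ∀ {x y} → x ∈ member → y ∈ member → x + y ∈ member
      *-closed : ∀ r {x} → x ∈ member → r * x ∈ member
  open Ideal

  -- The ideal generated by P.
  data Generated (P : Pred Carrier 0ℓ) : Pred Carrier 0ℓ where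
    generator : ∀ {x} → x ∈ P → Generated P x
    zeroᵍ     : Generated P 0#
    plusᵍ     : ∀ {x y} → Generated P x → Generated P y → Generated P (x + y)
    timesᵍ    : ∀ r {x} → Generated P x → Generated P (r * x)
    respᵍ     : ∀ {x y} → x ≈ y → Generated P x → Generated P y

  ⟨_⟩ : Pred Carrier 0ℓ → Ideal
  ⟨ P ⟩ = record
    { member = Generated P ; resp = respᵍ ; 0-member = zeroᵍ ; +-closed = plusᵍ ; *-closed = timesᵍ }

  unitIdeal : Ideal
  unitIdeal = ⟨ U ⟩

  _·_ : Ideal → Ideal → Ideal
  𝔞 · 𝔟 = ⟨ (λ x → ∃ λ a → ∃ λ b → a ∈ member 𝔞 × b ∈ member 𝔟 × x ≈ a * b) ⟩

  _^_ : Ideal → ℕ → Ideal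
  𝔞 ^ zero  = unitIdeal
  𝔞 ^ suc n = 𝔞 · (𝔞 ^ n)

  _∣_ : Ideal → Ideal → Set₁
  𝔟 ∣ 𝔞 = ∃ λ 𝔠 → member 𝔞 ≐ member (𝔟 · 𝔠)

  NonZero : Pred Ideal 0ℓ
  NonZero 𝔞 = ∃ λ x → x ∈ member 𝔞 × ¬ (x ≈ 0#)

  record NonZeroIdeal : Set₁ where
    field
      ideal   : Ideal
      nonZero : NonZero ideal
  open NonZeroIdeal

  record NonZeroPrime : Set₁ where
    field
      ideal   : Ideal
      nonZero : NonZero ideal
      proper  : 1# ∉ member ideal
      prime   : ∀ {x y} → x * y ∈ member ideal → x ∈ member ideal ⊎ y ∈ member ideal

  ^-nonZero : ∀ {𝔞} → NonZero 𝔞 → ∀ n → NonZero (𝔞 ^ n)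
  ^-nonZero _ zero = 1# , generator _ , 1≉0
  ^-nonZero nz@(x , x∈ , x≉0) (suc n) with ^-nonZero nz n
  ... | y , y∈ , y≉0 = x * y , generator (x , y , x∈ , y∈ , refl) , *-nonzero x≉0 y≉0

  _≡_mod_ : Carrier → Carrier → Ideal → Set
  x ≡ y mod 𝔞 = x - y ∈ member 𝔞

  module _ (𝔞 : Ideal) where
    open AbelianGroupProperties +-abelianGroup using (⁻¹-anti-homo‿-; ⁻¹-∙-comm)
    open RingProperties ring using (-1*x≈-x; x[y-z]≈xy-xz; [y-z]x≈yx-zx)
    open ≈-Reasoning setoid

    mod-refl : ∀ {x y} → x ≈ y → x ≡ y mod 𝔞
    mod-refl {x} {y} x≈y = resp 𝔞 (begin
      0#     ≈⟨ -‿inverseʳ y ⟨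
      y - y  ≈⟨ +-congʳ x≈y ⟨
      x - y  ∎) (0-member 𝔞)

    mod-sym : ∀ {x y} → x ≡ y mod 𝔞 → y ≡ x mod 𝔞
    mod-sym {x} {y} x~y = resp 𝔞 (begin
      - 1# * (x - y)  ≈⟨ -1*x≈-x (x - y) ⟩
      - (x - y)       ≈⟨ ⁻¹-anti-homo‿- x y ⟩
      y - x           ∎) (*-closed 𝔞 (- 1#) x~y)

    mod-trans : ∀ {x y z} → x ≡ y mod 𝔞 → y ≡ z mod 𝔞 → x ≡ z mod 𝔞
    mod-trans {x} {y} {z} x~y y~z = resp 𝔞 (begin
      (x - y) + (y - z)      ≈⟨ +-assoc x (- y) (y - z) ⟩
      x + (- y + (y - z))    ≈⟨ +-congˡ (+-assoc (- y) y (- z)) ⟨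
      x + ((- y + y) - z)    ≈⟨ +-congˡ (+-congʳ (-‿inverseˡ y)) ⟩
      x + (0# - z)           ≈⟨ +-congˡ (+-identityˡ (- z)) ⟩
      x - z                  ∎) (+-closed 𝔞 x~y y~z)

    mod-+ : ∀ {x y u v} → x ≡ y mod 𝔞 → u ≡ v mod 𝔞 → (x + u) ≡ (y + v) mod 𝔞
    mod-+ {x} {y} {u} {v} x~y u~v = resp 𝔞 (begin
      (x - y) + (u - v)      ≈⟨ +-assoc x (- y) (u - v) ⟩
      x + (- y + (u - v))    ≈⟨ +-congˡ (+-assoc (- y) u (- v)) ⟨
      x + ((- y + u) - v)    ≈⟨ +-congˡ (+-congʳ (+-comm (- y) u)) ⟩
      x + ((u - y) - v)      ≈⟨ +-congˡ (+-assoc u (- y) (- v)) ⟩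
      x + (u + (- y - v))    ≈⟨ +-assoc x u (- y - v) ⟨
      (x + u) + (- y - v)    ≈⟨ +-congˡ (⁻¹-∙-comm y v) ⟩
      (x + u) - (y + v)      ∎) (+-closed 𝔞 x~y u~v)

    mod-* : ∀ {x y u v} → x ≡ y mod 𝔞 → u ≡ v mod 𝔞 → (x * u) ≡ (y * v) mod 𝔞
    mod-* {x} {y} {u} {v} x~y u~v = mod-trans
      (resp 𝔞 (trans (*-comm u (x - y)) ([y-z]x≈yx-zx u x y)) (*-closed 𝔞 u x~y))
      (resp 𝔞 (x[y-z]≈xy-xz y u v) (*-closed 𝔞 y u~v))

    eval-mod : ∀ f {x y} → x ≡ y mod 𝔞 → eval R f x ≡ eval R f y mod 𝔞
    eval-mod []      x~y = mod-refl refl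
    eval-mod (c ∷ f) x~y = mod-+ (mod-refl refl) (mod-* x~y (eval-mod f x~y))

  R/_ : Ideal → Setoid 0ℓ 0ℓ
  R/ 𝔞 = record
    { Carrier = Carrier ; _≈_ = λ x y → x ≡ y mod 𝔞
    ; isEquivalence = record { refl = mod-refl 𝔞 refl ; sym = mod-sym 𝔞 ; trans = mod-trans 𝔞 } }

  -- The inverse limit of the rings R/𝔠ᵢ along the projections R/𝔠ᵢ → R/𝔠ᵢ′ for
  -- 𝔠ᵢ ⊆ 𝔠ᵢ′; a point chooses a representative of each residue class.
  record Lim {j} {J : Set j} (𝔠 : J → Ideal) : Set j where
    field
      at       : J → Carrier
      coherent : ∀ i i′ → member (𝔠 i) ⊆ member (𝔠 i′) → at i ≡ at i′ mod 𝔠 i′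
  open Lim

  -- Fibres of single projections form a neighbourhood base when the family 𝔠 is
  -- directed, as it is in both uses below (see _⊓_ for non-zero ideals).
  lim : ∀ {j} {J : Set j} → (J → Ideal) → Space j
  lim {J = J} 𝔠 = record
    { Point = Lim 𝔠 ; Scale = J ; near = λ i x y → at x i ≡ at y i mod 𝔠 i }

  R̂ : Space (lsuc 0ℓ)
  R̂ = lim ideal

  R̂₍_₎ : NonZeroPrime → Space 0ℓ
  R̂₍ 𝔭 ₎ = lim (NonZeroPrime.ideal 𝔭 ^_)

  open Space R̂ using () renaming (Point to R̂ₚₜ; Open to Openᴿ; Compact to Compactᴿ)

  primePower : NonZeroPrime → ℕ → NonZeroIdeal
  primePower 𝔭 j = record
    { ideal = NonZeroPrime.ideal 𝔭 ^ j ; nonZero = ^-nonZero (NonZeroPrime.nonZero 𝔭) j }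

  π^∞ : ∀ 𝔭 → R̂ₚₜ → Space.Point R̂₍ 𝔭 ₎
  π^∞ 𝔭 x = record
    { at       = λ j → at x (primePower 𝔭 j)
    ; coherent = λ i j → coherent x (primePower 𝔭 i) (primePower 𝔭 j) }

  _+̂_ : R̂ₚₜ → R̂ₚₜ → R̂ₚₜ
  x +̂ y = record
    { at       = λ 𝔞 → at x 𝔞 + at y 𝔞
    ; coherent = λ 𝔞 𝔟 𝔞⊆𝔟 → mod-+ (ideal 𝔟) (coherent x 𝔞 𝔟 𝔞⊆𝔟) (coherent y 𝔞 𝔟 𝔞⊆𝔟) }

  evalᴿ : List Carrier → R̂ₚₜ → R̂ₚₜ
  evalᴿ f x = record
    { at       = λ 𝔞 → eval R f (at x 𝔞)
    ; coherent = λ 𝔞 𝔟 𝔞⊆𝔟 → eval-mod (ideal 𝔟) f (coherent x 𝔞 𝔟 𝔞⊆𝔟) }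

  Subset : Set₂
  Subset = Pred R̂ₚₜ (lsuc 0ℓ)

  Subset^ : ℕ → Set₂
  Subset^ k = Pred (Fin k → R̂ₚₜ) (lsuc 0ℓ)

  module _ {k : ℕ} (X : Subset^ k) where

    closure : Subset^ k
    closure = Space.Closure (R̂ ^ₛ k) X

    image : ∀ 𝔭 → Pred (Fin k → Space.Point R̂₍ 𝔭 ₎) (lsuc 0ℓ)
    image 𝔭 z = ∃ λ x → x ∈ X × Space._≈ₛ_ (R̂₍ 𝔭 ₎ ^ₛ k) z (λ i → π^∞ 𝔭 (x i))

    local : ∀ 𝔭 → Pred (Fin k → Space.Point R̂₍ 𝔭 ₎) (lsuc 0ℓ)
    local 𝔭 = Space.Closure (R̂₍ 𝔭 ₎ ^ₛ k) (image 𝔭)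

    -- The product ∏ X(𝔭) is taken inside R̂^k via x ↦ (π^∞ 𝔭 x)_𝔭.
    Eulerian : Set₁
    Eulerian = closure ≐ (λ x → ∀ 𝔭 → (λ i → π^∞ 𝔭 (x i)) ∈ local 𝔭)

    OpenlyEulerian : Set₁
    OpenlyEulerian = Eulerian × (∀ 𝔭 → Space.Open (R̂₍ 𝔭 ₎ ^ₛ k) (local 𝔭))

  preimage : ∀ {k} → (Fin k → List Carrier) → Subset^ k → Subset
  preimage f Y a = (λ i → evalᴿ (f i) a) ∈ Y

  -- The cardinality of the image of P in R/𝔞 (0 if infinite).
  card : ∀ {p} (𝔞 : Ideal) → Pred Carrier p → ℕ
  card 𝔞 P with lem _ {∃ (HasCard (R/ 𝔞) P)}
  ... | yes (n , _) = n
  ... | no _        = 0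

  -- The image of S in R/𝔞, and the preimage in R̂ of that image.
  residues : Subset → (𝔞 : NonZeroIdeal) → Pred Carrier (lsuc 0ℓ)
  residues S 𝔞 r = ∃ λ x → x ∈ S × at x 𝔞 ≡ r mod ideal 𝔞

  thicken : Subset → NonZeroIdeal → Subset
  thicken S 𝔞 x = at x 𝔞 ∈ residues S 𝔞

  record CompactOpen : Set₂ where
    no-eta-equality
    field
      set     : Subset
      open′   : Openᴿ set
      compact : Compactᴿ set
  open CompactOpen

  thicken-open : ∀ S 𝔞 → Openᴿ (thicken S 𝔞)
  thicken-open S 𝔞 y (x , x∈S , x~y) = 𝔞 , λ z y~z → x , x∈S , mod-trans (ideal 𝔞) x~y y~z

  thicken-closed : ∀ S 𝔞 → Openᴿ (∁ (thicken S 𝔞))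
  thicken-closed S 𝔞 y y∉ = 𝔞 , λ z y~z (x , x∈S , x~z) →
    y∉ (x , x∈S , mod-trans (ideal 𝔞) x~z (mod-sym (ideal 𝔞) y~z))

  -- A closed subset of a compact set is compact: cover the complement as well.
  ∩-compact : ∀ {K C} → Compactᴿ K → Openᴿ (∁ C) → Compactᴿ (K ∩ C)
  ∩-compact {K} {C} K-compact ∁C-open {I} V V-open covers = catMaybes (proj₁ finite) ,
      λ (x∈K , x∈C) → extract x∈C (proj₂ finite x∈K)
    where
      V⁺ : Maybe I → Subset
      V⁺ (just i) = V i
      V⁺ nothing  = ∁ C
      V⁺-open : ∀ i → Openᴿ (V⁺ i)
      V⁺-open (just i) = V-open i
      V⁺-open nothing  = ∁C-open
      covers⁺ : K ⊆ (λ x → ∃ λ i → x ∈ V⁺ i)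
      covers⁺ {x} x∈K with lem _ {x ∈ C}
      ... | yes x∈C = let (i , x∈Vᵢ) = covers (x∈K , x∈C) in just i , x∈Vᵢ
      ... | no x∉C  = nothing , x∉C
      finite = K-compact V⁺ V⁺-open covers⁺
      extract : ∀ {x is} → x ∈ C → Any (λ i → x ∈ V⁺ i) is → Any (λ i → x ∈ V i) (catMaybes is)
      extract {is = just i ∷ is}  x∈C (here p)  = here p
      extract {is = nothing ∷ is} x∈C (here p)  = contradiction x∈C p
      extract {is = just i ∷ is}  x∈C (there p) = there (extract x∈C p)
      extract {is = nothing ∷ is} x∈C (there p) = extract x∈C p

  _⊓_ : NonZeroIdeal → NonZeroIdeal → NonZeroIdeal
  𝔞 ⊓ 𝔟 = record
    { ideal = record
      { member   = member (ideal 𝔞) ∩ member (ideal 𝔟)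
      ; resp     = λ x≈y (p , q) → resp (ideal 𝔞) x≈y p , resp (ideal 𝔟) x≈y q
      ; 0-member = 0-member (ideal 𝔞) , 0-member (ideal 𝔟)
      ; +-closed = λ (p , q) (p′ , q′) → +-closed (ideal 𝔞) p p′ , +-closed (ideal 𝔟) q q′
      ; *-closed = λ r (p , q) → *-closed (ideal 𝔞) r p , *-closed (ideal 𝔟) r q }
    ; nonZero =
        let (x , x∈𝔞 , x≉0) = nonZero 𝔞 ; (y , y∈𝔟 , y≉0) = nonZero 𝔟 in
        x * y
        , (resp (ideal 𝔞) (*-comm y x) (*-closed (ideal 𝔞) y x∈𝔞) , *-closed (ideal 𝔟) x y∈𝔟)
        , *-nonzero x≉0 y≉0 }

  near-⊆ : ∀ 𝔞 𝔟 → member (ideal 𝔞) ⊆ member (ideal 𝔟) →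
           ∀ {x y} → Space.near R̂ 𝔞 x y → Space.near R̂ 𝔟 x y
  near-⊆ 𝔞 𝔟 𝔞⊆𝔟 {x} {y} x~y = mod-trans (ideal 𝔟)
    (mod-sym (ideal 𝔟) (coherent x 𝔞 𝔟 𝔞⊆𝔟))
    (mod-trans (ideal 𝔟) (𝔞⊆𝔟 x~y) (coherent y 𝔞 𝔟 𝔞⊆𝔟))

  ∩-open : ∀ {V W : Subset} → Openᴿ V → Openᴿ W → Openᴿ (V ∩ W)
  ∩-open V-open W-open x (x∈V , x∈W) =
    let (𝔞 , p) = V-open x x∈V ; (𝔟 , q) = W-open x x∈W in
    𝔞 ⊓ 𝔟 , λ y x~y →
      p y (near-⊆ (𝔞 ⊓ 𝔟) 𝔞 proj₁ {x} {y} x~y) , q y (near-⊆ (𝔞 ⊓ 𝔟) 𝔟 proj₂ {x} {y} x~y)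

  _∩thicken[_,_] : CompactOpen → Subset → NonZeroIdeal → CompactOpen
  (V ∩thicken[ S , 𝔞 ]) .set     = set V ∩ thicken S 𝔞
  (V ∩thicken[ S , 𝔞 ]) .open′   = ∩-open {set V} {thicken S 𝔞} (open′ V) (thicken-open S 𝔞)
  (V ∩thicken[ S , 𝔞 ]) .compact = ∩-compact {set V} {thicken S 𝔞} (compact V) (thicken-closed S 𝔞)

  -- Finitely additive functions of compact open sets, i.e. linear functionals on
  -- the locally constant functions.
  record Distribution : Set₂ where
    field
      ⟪_⟫      : CompactOpen → ℝ
      cong     : ∀ V W → set V ≐ set W → ⟪ V ⟫ ≈ᵣ ⟪ W ⟫
      additive : ∀ V W T → set T ≐ set V ∪ set W → Empty (set V ∩ set W) →
                 ⟪ T ⟫ ≈ᵣ ⟪ V ⟫ +ᵣ ⟪ W ⟫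
  open Distribution

  -- The restriction of the Haar measure to compact open sets.  It determines the
  -- measure, and countable additivity on these sets is automatic by compactness.
  -- Translates, and the total space, are quantified over as compact open sets V, W
  -- with the stated underlying sets.
  record IsNormalizedHaar (μ : Distribution) : Set₂ where
    field
      nonneg     : ∀ V → 0ᵣ ≤ᵣ ⟪ μ ⟫ V
      normalized : ∀ V → (∀ x → x ∈ set V) → ⟪ μ ⟫ V ≈ᵣ 1ᵣ
      invariant  : ∀ c V W → (∀ x → x ∈ set V ⇔ (x +̂ c) ∈ set W) → ⟪ μ ⟫ V ≈ᵣ ⟪ μ ⟫ W

  module _ (μ : Distribution) (S : Subset) where

    -- The factor is ∣R/𝔞∣ ÷ ∣π(S)∣; for empty S it is m ÷ 0 = 0, as required.
    μ̃ : NonZeroIdeal → CompactOpen → ℝ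
    μ̃ 𝔞 V = fromℚ (card (ideal 𝔞) U ÷ card (ideal 𝔞) (residues S 𝔞))
            *ᵣ ⟪ μ ⟫ (V ∩thicken[ S , 𝔞 ])

    -- ν is the limit of the net μ̃ 𝔞; the inequalities say ∣ μ̃ 𝔞 V - ν V ∣ < ε.
    IsProcounting : Distribution → Set₂
    IsProcounting ν = ∀ V ε → 0ᵣ <ᵣ ε → ∃ λ (𝔟 : NonZeroIdeal) → ∀ (𝔞 : NonZeroIdeal) →
      ideal 𝔟 ∣ ideal 𝔞 → μ̃ 𝔞 V <ᵣ ⟪ ν ⟫ V +ᵣ ε × ⟪ ν ⟫ V <ᵣ μ̃ 𝔞 V +ᵣ ε

{-# OPTIONS --safe #-}

-- The net is eventually constant on every compact open V.  If some residue ring is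
-- infinite, the junk value card = 0 makes the net vanish below that ideal; assume
-- from now on that all residue rings are finite.
--
-- The Eulerian condition describes S = f⁻¹(X̂) by separate conditions E 𝔭 on the
-- components at the primes.  Let V be a union of residue classes modulo 𝔟, and pick a
-- non-zero β ∈ 𝔟.  Powers of β that are idempotent modulo 𝔞, for varying 𝔞, form an
-- idempotent ε of R̂ that is 0 at the primes containing β and 1 at the others.
-- Only finitely many primes contain β, so the conditions E 𝔭 at these define an open
-- set, which by compactness is a union of residue classes modulo some 𝔡; moreover
-- 𝔡 can be chosen such that ε ≡ 0 and V is still a union of classes modulo 𝔡.  Then for
-- s, s′ ∈ S the translation by (1 - ε) (s′ - s) maps the part of S that is congruent to s
-- modulo 𝔡 onto the part congruent to s′: at the primes containing β it
-- stays in the same classes modulo 𝔡 as s′, and elsewhere it changes nothing.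
-- So S is equidistributed among the classes modulo 𝔡 that it meets, and for
-- 𝔞 ⊆ 𝔡 the value at V is the proportion of these classes that meet S ∩ V.

module Submission where

open import Level using (0ℓ)
open import Algebra.Bundles using (CommutativeRing)
open import Algebra.Apartness.Bundles using (HeytingField)
import Algebra.Properties.AbelianGroup as AbelianGroupProperties
import Algebra.Properties.Ring as RingProperties
import Algebra.Properties.Semiring.Exp as Exp
open import Axiom.ExcludedMiddle using (ExcludedMiddle)
open import Data.Fin.Base using (Fin; zero; suc; toℕ; funToFin; finToFun)
open import Data.Fin.Properties using (suc-injective; 0≢1+n; pigeonhole; finToFun-funToFin)
import Data.Integer.Base as ℤ
import Data.Integer.Properties as ℤ
open import Data.List.Base using (List; []; _∷_; concat; tabulate; allFin)
open import Data.List.Membership.Propositional using (find) renaming (_∈_ to _∈ˡ_)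
open import Data.List.Membership.Propositional.Properties using (∈-allFin)
open import Data.List.Relation.Unary.Any using (Any; here; there)
import Data.List.Relation.Unary.Any as Any
import Data.List.Relation.Unary.Any.Properties as Any
open import Data.Nat.Base using (ℕ; zero; suc)
import Data.Nat.Base as ℕ
import Data.Nat.Properties as ℕ
open import Data.Product using (∃; _×_; _,_; proj₁; proj₂)
open import Data.Rational as ℚ using (ℚ; 0ℚ; 1ℚ; ∣_∣)
import Data.Rational.Properties as ℚ
open import Data.Rational.Solver using (module +-*-Solver)
import Data.Rational.Unnormalised as ℚᵘ
import Data.Rational.Unnormalised.Properties as ℚᵘ
open import Data.Sum using (inj₁; inj₂; [_,_]′)
open import Data.Unit using (tt)
open import Data.Unit.Polymorphic using (⊤)
open import Function using (_∘_; mk⇔; Bijection)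
open import Relation.Binary.Bundles using (Setoid)
import Relation.Binary.Reasoning.Setoid as ≈-Reasoning
open import Relation.Binary.PropositionalEquality using (_≡_; _≢_)
import Relation.Binary.PropositionalEquality as ≡
open import Relation.Nullary using (¬_; Dec; yes; no; contradiction)
open import Relation.Nullary.Decidable using (decidable-stable)
open import Relation.Unary using (Pred; _∈_; _∉_; _⊆_; _≐_; _∩_; _∪_; ∁; U; Empty)
open import Defs

-- Real numbers

pointwise⇒≈ᵣ : ∀ {x y} → (∀ n → seq x n ≡ seq y n) → x ≈ᵣ y
pointwise⇒≈ᵣ {x} {y} e = mk≈ λ ε 0<ε → 0 , λ n _ → ≡.subst (ℚ._< ε)
    (≡.sym (≡.trans (≡.cong (λ t → ∣ t ℚ.- seq y n ∣) (e n)) (≡.cong ∣_∣ (ℚ.+-inverseʳ (seq y n))))) 0<ε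

ℝ-setoid : Setoid 0ℓ 0ℓ
ℝ-setoid = record
  { _≈_ = _≈ᵣ_
  ; isEquivalence = record { refl = pointwise⇒≈ᵣ λ _ → ≡.refl ; sym = ≈ᵣ-sym ; trans = ≈ᵣ-trans } }

+ᵣ-cong : ∀ {x x′ y y′} → x ≈ᵣ x′ → y ≈ᵣ y′ → x +ᵣ y ≈ᵣ x′ +ᵣ y′
+ᵣ-cong {x} {x′} {y} {y′} p q = mk≈ λ ε 0<ε →
  let (η , 0<η , η+η≡ε) = halve 0<ε in
  mapE (λ {n} (a , b) → ≡.subst (∣ (seq x n ℚ.+ seq y n) ℚ.- (seq x′ n ℚ.+ seq y′ n) ∣ ℚ.<_) η+η≡ε
         (sum-close (seq x n) (seq y n) (seq x′ n) (seq y′ n) a b))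
    (both (close p η 0<η) (close q η 0<η))

infixr 7 _⋆_
_⋆_ : ℚ → ℝ → ℝ
q ⋆ x = fromℚ q *ᵣ x

⋆-congˡ : ∀ q {x y} → x ≈ᵣ y → q ⋆ x ≈ᵣ q ⋆ y
⋆-congˡ q {x} {y} p = mk≈ λ ε 0<ε →
    let (δ , 0<δ , f) = shrink B 0<B ε 0<ε in
    mapE (λ {n} h → ≡.subst (λ t → ∣ t ∣ ℚ.< ε) (lem q (seq x n) (seq y n)) (f q (seq x n ℚ.- seq y n) q≤B h))
      (close p δ 0<δ)
  where
    open +-*-Solver
    -- The summand 1 keeps the bound positive when `q` is 0, as `shrink` demands.
    B = ∣ q ∣ ℚ.+ 1ℚ
    0<B : 0ℚ ℚ.< B
    0<B = ℚ.+-mono-≤-< (ℚ.0≤∣p∣ q) (ℚ.positive⁻¹ 1ℚ)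
    q≤B : ∣ q ∣ ℚ.≤ B
    q≤B = ≡.subst (ℚ._≤ B) (ℚ.+-identityʳ ∣ q ∣) (ℚ.+-monoʳ-≤ ∣ q ∣ (ℚ.nonNegative⁻¹ 1ℚ))
    lem : ∀ q x y → q ℚ.* (x ℚ.- y) ≡ q ℚ.* x ℚ.- q ℚ.* y
    lem = solve 3 (λ q x y → q :* (x :- y) := q :* x :- q :* y) ≡.refl

⋆-assoc : ∀ p q x → p ⋆ (q ⋆ x) ≈ᵣ (p ℚ.* q) ⋆ x
⋆-assoc p q x = pointwise⇒≈ᵣ λ n → ≡.sym (ℚ.*-assoc p q (seq x n))

⋆-comm : ∀ p q x → p ⋆ (q ⋆ x) ≈ᵣ q ⋆ (p ⋆ x)
⋆-comm p q x = ≈ᵣ-trans (⋆-assoc p q x) (≈ᵣ-trans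
  (pointwise⇒≈ᵣ λ n → ≡.cong (ℚ._* seq x n) (ℚ.*-comm p q)) (≈ᵣ-sym (⋆-assoc q p x)))

⋆-zeroˡ : ∀ x → 0ℚ ⋆ x ≈ᵣ 0ᵣ
⋆-zeroˡ x = pointwise⇒≈ᵣ λ n → ℚ.*-zeroˡ (seq x n)

⋆-zeroʳ : ∀ q {x} → x ≈ᵣ 0ᵣ → q ⋆ x ≈ᵣ 0ᵣ
⋆-zeroʳ q x≈0 = ≈ᵣ-trans (⋆-congˡ q x≈0) (pointwise⇒≈ᵣ λ _ → ℚ.*-zeroʳ q)

-- Serves to give the empty set measure 0, as it is the disjoint union of itself with itself.
≈+self⇒≈0 : ∀ {x} → x ≈ᵣ x +ᵣ x → x ≈ᵣ 0ᵣ
≈+self⇒≈0 {x} p = mk≈ λ ε 0<ε → mapE (λ {n} → ≡.subst (ℚ._< ε)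
    (≡.trans (≡.cong ∣_∣ (lem (seq x n))) (≡.trans (ℚ.∣-p∣≡∣p∣ (seq x n))
      (≡.cong ∣_∣ (≡.sym (ℚ.+-identityʳ (seq x n))))))) (close p ε 0<ε)
  where
    open +-*-Solver
    lem : ∀ a → a ℚ.- (a ℚ.+ a) ≡ ℚ.- a
    lem = solve 1 (λ a → a :- (a :+ a) := :- a) ≡.refl

≈⇒<+ : ∀ {x y ε} → x ≈ᵣ y → 0ᵣ <ᵣ ε → x <ᵣ y +ᵣ ε
≈⇒<+ {x} {y} {ε} p (mk< g 0<g q) =
  -- One half of the gap absorbs the distance from `x` to `y`; the other half is the gap that
  -- remains.
  let (h , 0<h , h+h≡g) = halve 0<g in
  mk< h 0<h (mapE (λ {n} (a , b) → ℚ.≤-trans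
      (ℚ.+-monoˡ-≤ h (ℚ.<⇒≤ (close⇒< (seq x n) (seq y n) a)))
      (ℚ.≤-trans (ℚ.≤-reflexive (≡.trans (ℚ.+-assoc (seq y n) h h) (≡.cong (seq y n ℚ.+_) h+h≡g)))
        (ℚ.+-monoʳ-≤ (seq y n) (≡.subst (ℚ._≤ seq ε n) (ℚ.+-identityˡ g) b))))
    (both (close p h 0<h) q))

ι : ℕ → ℚ
ι n = n ÷ 1

-- Normalisation by the gcd blocks computation for a variable `n`; among unnormalised rationals the
-- equation is a cross-multiplication of integers.
ι-suc : ∀ n → ι (suc n) ≡ 1ℚ ℚ.+ ι n
ι-suc n = ℚ.toℚᵘ-injective (begin
    ℚ.toℚᵘ (ι (suc n))                       ≈⟨ ℚ.toℚᵘ-fromℚᵘ (ℚᵘ.mkℚᵘ (ℤ.+ suc n) 0) ⟩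
    ℚᵘ.mkℚᵘ (ℤ.+ suc n) 0                    ≈⟨ ℚᵘ.*≡* (≡.cong (λ t → (ℤ.1ℤ ℤ.+ t) ℤ.* ℤ.1ℤ) (≡.sym (ℤ.*-identityʳ (ℤ.+ n)))) ⟩
    ℚᵘ.1ℚᵘ ℚᵘ.+ ℚᵘ.mkℚᵘ (ℤ.+ n) 0            ≈⟨ ℚᵘ.+-congʳ ℚᵘ.1ℚᵘ (ℚ.toℚᵘ-fromℚᵘ (ℚᵘ.mkℚᵘ (ℤ.+ n) 0)) ⟨
    ℚ.toℚᵘ 1ℚ ℚᵘ.+ ℚ.toℚᵘ (ι n)              ≈⟨ ℚ.toℚᵘ-homo-+ 1ℚ (ι n) ⟨
    ℚ.toℚᵘ (1ℚ ℚ.+ ι n)                      ∎)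
  where open ℚᵘ.≃-Reasoning

÷-cancel : ∀ m {n} → ¬ n ≡ 0 → (m ÷ n) ℚ.* ι n ≡ ι m
÷-cancel m {zero}  n≢0 = contradiction ≡.refl n≢0
÷-cancel m {suc n} _   = ℚ.toℚᵘ-injective (begin
    ℚ.toℚᵘ ((m ÷ suc n) ℚ.* ι (suc n))            ≈⟨ ℚ.toℚᵘ-homo-* (m ÷ suc n) (ι (suc n)) ⟩
    ℚ.toℚᵘ (m ÷ suc n) ℚᵘ.* ℚ.toℚᵘ (ι (suc n))    ≈⟨ ℚᵘ.*-cong (ℚ.toℚᵘ-fromℚᵘ (ℚᵘ.mkℚᵘ (ℤ.+ m) n)) (ℚ.toℚᵘ-fromℚᵘ (ℚᵘ.mkℚᵘ (ℤ.+ suc n) 0)) ⟩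
    ℚᵘ.mkℚᵘ (ℤ.+ m) n ℚᵘ.* ℚᵘ.mkℚᵘ (ℤ.+ suc n) 0  ≈⟨ ℚᵘ.*≡* (≡.trans (ℤ.*-identityʳ _) (≡.cong (λ t → ℤ.+ m ℤ.* ℤ.+ t) (≡.sym (ℕ.*-identityʳ (suc n))))) ⟩
    ℚᵘ.mkℚᵘ (ℤ.+ m) 0                             ≈⟨ ℚ.toℚᵘ-fromℚᵘ (ℚᵘ.mkℚᵘ (ℤ.+ m) 0) ⟨
    ℚ.toℚᵘ (ι m)                                  ∎)
  where open ℚᵘ.≃-Reasoning

ι-suc-⋆ : ∀ n x → ι (suc n) ⋆ x ≈ᵣ x +ᵣ ι n ⋆ x
ι-suc-⋆ n x = pointwise⇒≈ᵣ λ k → ≡.trans (≡.cong (ℚ._* seq x k) (ι-suc n))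
  (≡.trans (ℚ.*-distribʳ-+ (seq x k) 1ℚ (ι n)) (≡.cong (ℚ._+ ι n ℚ.* seq x k) (ℚ.*-identityˡ (seq x k))))

0÷ : ∀ n → 0 ÷ n ≡ 0ℚ
0÷ zero    = ≡.refl
0÷ (suc n) = ℚ.0/n≡0 (suc n)

-- Cardinalities

module _ {a ℓ} (A : Setoid a ℓ) where
  open Setoid A using (Carrier; _≈_) renaming (trans to ≈-trans; sym to ≈-sym; refl to ≈-refl)

  hasCard : ∀ {p} {P : Pred Carrier p} {n} (f : Fin n → Carrier) → (∀ i → f i ∈ P) →
            (∀ i j → f i ≈ f j → i ≡ j) → (∀ x → x ∈ P → ∃ λ i → f i ≈ x) → HasCard A P n
  hasCard {P = P} f f∈P inj sur = record
    { to        = λ i → f i , f∈P i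
    ; cong      = λ { ≡.refl → ≈-refl }
    ; bijective = (λ {i} {j} → inj i j) ,
                  λ (x , x∈P) → proj₁ (sur x x∈P) , λ { ≡.refl → proj₂ (sur x x∈P) } }

  module Enumeration {p} {P : Pred Carrier p} {n} (h : HasCard A P n) where
    open Bijection h

    element : Fin n → Carrier
    element i = proj₁ (to i)

    element∈ : ∀ i → element i ∈ P
    element∈ i = proj₂ (to i)

    element-injective : ∀ i j → element i ≈ element j → i ≡ j
    element-injective i j = injective

    index : ∀ x → x ∈ P → Fin n
    index x x∈P = proj₁ (surjective (x , x∈P))

    element-index : ∀ x (x∈P : x ∈ P) → element (index x x∈P) ≈ x
    element-index x x∈P = proj₂ (surjective (x , x∈P)) ≡.refl

  -- Induction on the length of the cover: either no element of `P` is equivalent to `f zero`, which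
  -- is then dropped, or one is, and the tail covers the elements of `P` outside its class.
  covered⇒hasCard : (lem : ∀ ℓ → ExcludedMiddle ℓ) → ∀ {p} (P : Pred Carrier p) {n} (f : Fin n → Carrier) →
                    (∀ x → x ∈ P → ∃ λ i → f i ≈ x) → ∃ λ m → HasCard A P m
  covered⇒hasCard lem P {zero} f cover =
    0 , hasCard f (λ ()) (λ ()) cover
  covered⇒hasCard lem P {suc n} f cover with lem _ {∃ λ x → x ∈ P × f zero ≈ x}
  ... | no ∄ = covered⇒hasCard lem P (f ∘ suc) λ x x∈P → cover′ x x∈P (cover x x∈P)
    where
      cover′ : ∀ x → x ∈ P → (∃ λ i → f i ≈ x) → ∃ λ i → f (suc i) ≈ x
      cover′ x x∈P (zero , e)  = contradiction (x , x∈P , e) ∄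
      cover′ x x∈P (suc i , e) = i , e
  -- `P` need not respect the equivalence, so `x₀` and not `f zero` enters the enumeration.
  ... | yes (x₀ , x₀∈P , e₀) =
      let (m , h) = covered⇒hasCard lem P′ (f ∘ suc) (λ x (x∈P , x≉) → cover′ x x≉ (cover x x∈P))
      in suc m , extend h
    where
      P′ : Pred Carrier _
      P′ x = x ∈ P × ¬ (x₀ ≈ x)
      cover′ : ∀ x → ¬ (x₀ ≈ x) → (∃ λ i → f i ≈ x) → ∃ λ i → f (suc i) ≈ x
      cover′ x x≉ (zero , e)  = contradiction (≈-trans (≈-sym e₀) e) x≉
      cover′ x x≉ (suc i , e) = i , e
      extend : ∀ {m} → HasCard A P′ m → HasCard A P (suc m)
      extend {m} h = hasCard g g∈P inj sur
        where
          open Enumeration h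
          g : Fin (suc m) → Carrier
          g zero    = x₀
          g (suc i) = element i
          g∈P : ∀ i → g i ∈ P
          g∈P zero    = x₀∈P
          g∈P (suc i) = proj₁ (element∈ i)
          inj : ∀ i j → g i ≈ g j → i ≡ j
          inj zero    zero    e = ≡.refl
          inj zero    (suc j) e = contradiction e (proj₂ (element∈ j))
          inj (suc i) zero    e = contradiction (≈-sym e) (proj₂ (element∈ i))
          inj (suc i) (suc j) e = ≡.cong suc (element-injective i j e)
          sur : ∀ x → x ∈ P → ∃ λ i → g i ≈ x
          sur x x∈P with lem _ {x₀ ≈ x}
          ... | yes e = zero , e
          ... | no ¬e = suc (index x (x∈P , ¬e)) , element-index x (x∈P , ¬e)

-- Codes truth values as digits, so that finitely many of them form one number below a power of 2.
indicator : ∀ {p} {P : Set p} → Dec P → Fin 2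
indicator (yes _) = zero
indicator (no _)  = suc zero

indicator-≡ : ∀ {p q} {P : Set p} {Q : Set q} (P? : Dec P) (Q? : Dec Q) →
              indicator P? ≡ indicator Q? → P → Q
indicator-≡ _       (yes q) _ _ = q
indicator-≡ (no ¬p) _       _ p = contradiction p ¬p
indicator-≡ (yes _) (no _)  ()

module ProcountingTheory (lem : ∀ ℓ → ExcludedMiddle ℓ) (R : CommutativeRing 0ℓ 0ℓ) (isDomain : IsDomain R) where
  open Procounting lem R isDomain
  open CommutativeRing R hiding (zero)
  open IsDomain isDomain
  open Ideal
  open NonZeroIdeal
  open Lim
  open CompactOpen
  open Distribution using (⟪_⟫; additive)
  open Exp semiring using (^-homo-*; ^-assocʳ) renaming (_^_ to _↑_)
  open Space R̂ using () renaming (Point to R̂ₚₜ; Open to Openᴿ; Compact to Compactᴿ; near to nearᴿ)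

  -- Residue rings and idempotents

  infix 4 _⊑_
  _⊑_ : NonZeroIdeal → NonZeroIdeal → Set
  𝔞 ⊑ 𝔟 = member (ideal 𝔞) ⊆ member (ideal 𝔟)

  module _ (𝔞 : Ideal) where

    mod-‿- : ∀ {x y} → x ≡ y mod 𝔞 → (- x) ≡ (- y) mod 𝔞
    mod-‿- {x} {y} x~y = mod-trans 𝔞 (mod-refl 𝔞 (sym (-1*x≈-x x)))
      (mod-trans 𝔞 (mod-* 𝔞 (mod-refl 𝔞 refl) x~y) (mod-refl 𝔞 (-1*x≈-x y)))
      where open RingProperties ring using (-1*x≈-x)

    -- Makes ring identities available for congruences modulo `𝔞`.
    quotient : CommutativeRing 0ℓ 0ℓ
    quotient = record
      { _≈_ = λ x y → x ≡ y mod 𝔞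
      ; _+_ = _+_ ; _*_ = _*_ ; -_ = -_ ; 0# = 0# ; 1# = 1#
      ; isCommutativeRing = record
        { isRing = record
          { +-isAbelianGroup = record
            { isGroup = record
              { isMonoid = record
                { isSemigroup = record
                  { isMagma = record
                    { isEquivalence = Setoid.isEquivalence (R/ 𝔞)
                    ; ∙-cong        = mod-+ 𝔞 }
                  ; assoc = λ x y z → mod-refl 𝔞 (+-assoc x y z) }
                ; identity = (λ x → mod-refl 𝔞 (+-identityˡ x)) , (λ x → mod-refl 𝔞 (+-identityʳ x)) }
              ; inverse = (λ x → mod-refl 𝔞 (-‿inverseˡ x)) , (λ x → mod-refl 𝔞 (-‿inverseʳ x))
              ; ⁻¹-cong = mod-‿- }
            ; comm = λ x y → mod-refl 𝔞 (+-comm x y) }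
          ; *-cong = mod-* 𝔞
          ; *-assoc = λ x y z → mod-refl 𝔞 (*-assoc x y z)
          ; *-identity = (λ x → mod-refl 𝔞 (*-identityˡ x)) , (λ x → mod-refl 𝔞 (*-identityʳ x))
          ; distrib = (λ x y z → mod-refl 𝔞 (distribˡ x y z)) , (λ x y z → mod-refl 𝔞 (distribʳ x y z)) }
        ; *-comm = λ x y → mod-refl 𝔞 (*-comm x y) } }

    ∈⇒≡0 : ∀ {x} → x ∈ member 𝔞 → x ≡ 0# mod 𝔞
    ∈⇒≡0 {x} = resp 𝔞 (sym (trans (+-congˡ -0#≈0#) (+-identityʳ x)))
      where open RingProperties ring using (-0#≈0#)

    ≡0⇒∈ : ∀ {x} → x ≡ 0# mod 𝔞 → x ∈ member 𝔞
    ≡0⇒∈ {x} = resp 𝔞 (trans (+-congˡ -0#≈0#) (+-identityʳ x))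
      where open RingProperties ring using (-0#≈0#)

    *-closedʳ : ∀ {x} → x ∈ member 𝔞 → ∀ r → x * r ∈ member 𝔞
    *-closedʳ {x} x∈ r = resp 𝔞 (*-comm r x) (*-closed 𝔞 r x∈)

  Idempotent : Ideal → Carrier → Set
  Idempotent 𝔞 e = (e * e) ≡ e mod 𝔞

  idempotent-↑ : ∀ 𝔞 {e} → Idempotent 𝔞 e → ∀ n → (e ↑ suc n) ≡ e mod 𝔞
  idempotent-↑ 𝔞 {e} ee zero    = mod-refl 𝔞 (*-identityʳ e)
  idempotent-↑ 𝔞 {e} ee (suc n) = mod-trans 𝔞 (mod-* 𝔞 (mod-refl 𝔞 refl) (idempotent-↑ 𝔞 ee n)) ee

  -- Among the powers of x some two agree, so they are eventually periodic, and
  -- a multiple of the period that is past the preperiod gives an idempotent.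
  idempotent-power : ∀ 𝔞 {n} → HasCard (R/ 𝔞) U n → ∀ x → ∃ λ m → Idempotent 𝔞 (x ↑ suc m)
  idempotent-power 𝔞 {n} h x = go (pigeonhole (ℕ.n<1+n n) (λ i → index (x ↑ toℕ i) tt))
    where
      open Enumeration (R/ 𝔞) h
      open ≈-Reasoning (R/ 𝔞)
      module Periodic (i d : ℕ) (xⁱ : (x ↑ (i ℕ.+ suc d)) ≡ (x ↑ i) mod 𝔞) where
        D = suc d

        step : ∀ l → i ℕ.≤ l → (x ↑ (l ℕ.+ D)) ≡ (x ↑ l) mod 𝔞
        step l i≤l with ℕ.m≤n⇒∃[o]m+o≡n i≤l
        ... | r , ≡.refl = begin
          x ↑ (i ℕ.+ r ℕ.+ D)       ≡⟨ ≡.cong (x ↑_) (≡.trans (ℕ.+-assoc i r D) (≡.trans (≡.cong (i ℕ.+_) (ℕ.+-comm r D)) (≡.sym (ℕ.+-assoc i D r)))) ⟩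
          x ↑ (i ℕ.+ D ℕ.+ r)       ≈⟨ mod-refl 𝔞 (^-homo-* x (i ℕ.+ D) r) ⟩
          (x ↑ (i ℕ.+ D)) * (x ↑ r) ≈⟨ mod-* 𝔞 xⁱ (mod-refl 𝔞 refl) ⟩
          (x ↑ i) * (x ↑ r)         ≈⟨ mod-refl 𝔞 (^-homo-* x i r) ⟨
          x ↑ (i ℕ.+ r)             ∎

        period : ∀ k l → i ℕ.≤ l → (x ↑ (l ℕ.+ k ℕ.* D)) ≡ (x ↑ l) mod 𝔞
        period zero    l i≤l = mod-refl 𝔞 (reflexive (≡.cong (x ↑_) (ℕ.+-identityʳ l)))
        period (suc k) l i≤l = begin
          x ↑ (l ℕ.+ (D ℕ.+ k ℕ.* D))  ≡⟨ ≡.cong (x ↑_) (ℕ.+-assoc l D (k ℕ.* D)) ⟨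
          x ↑ (l ℕ.+ D ℕ.+ k ℕ.* D)    ≈⟨ period k (l ℕ.+ D) (ℕ.≤-trans i≤l (ℕ.m≤m+n l D)) ⟩
          x ↑ (l ℕ.+ D)                ≈⟨ step l i≤l ⟩
          x ↑ l                        ∎

        M = suc i ℕ.* D

        i≤M : i ℕ.≤ M
        i≤M = ℕ.≤-trans (ℕ.m≤m*n i D) (ℕ.m≤n+m (i ℕ.* D) D)

        idem : Idempotent 𝔞 (x ↑ M)
        idem = mod-trans 𝔞 (mod-refl 𝔞 (sym (^-homo-* x M M))) (period (suc i) M i≤M)

      go : _ → ∃ λ m → Idempotent 𝔞 (x ↑ suc m)
      go (i , j , i<j , same) with ℕ.m≤n⇒∃[o]m+o≡n i<j
      -- The successor of the exponent given here is `suc i * suc d`, which is `M`.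
      ... | d , i+d≡j = d ℕ.+ toℕ i ℕ.* suc d , Periodic.idem (toℕ i) d (begin
          x ↑ (toℕ i ℕ.+ suc d)            ≡⟨ ≡.cong (x ↑_) (≡.trans (ℕ.+-suc (toℕ i) d) i+d≡j) ⟩
          x ↑ toℕ j                         ≈⟨ element-index (x ↑ toℕ j) tt ⟨
          element (index (x ↑ toℕ j) tt)    ≡⟨ ≡.cong element same ⟨
          element (index (x ↑ toℕ i) tt)    ≈⟨ element-index (x ↑ toℕ i) tt ⟩
          x ↑ toℕ i                         ∎)

  idempotent-orthogonal : ∀ 𝔞 {e} → Idempotent 𝔞 e → (1# - e) * e ∈ member 𝔞
  idempotent-orthogonal 𝔞 {e} ee = ≡0⇒∈ 𝔞 (begin
      (1# - e) * e      ≈⟨ [y-z]x≈yx-zx e 1# e ⟩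
      1# * e - e * e    ≈⟨ Q.+-cong (Q.*-identityˡ e) (mod-‿- 𝔞 ee) ⟩
      e - e             ≈⟨ Q.-‿inverseʳ e ⟩
      0#                ∎)
    where
      module Q = CommutativeRing (quotient 𝔞)
      open RingProperties Q.ring using ([y-z]x≈yx-zx)
      open ≈-Reasoning Q.setoid

  complement-idempotent : ∀ 𝔞 {e} → Idempotent 𝔞 e → Idempotent 𝔞 (1# - e)
  complement-idempotent 𝔞 {e} ee = begin
      (1# - e) * (1# - e)            ≈⟨ [y-z]x≈yx-zx (1# - e) 1# e ⟩
      1# * (1# - e) - e * (1# - e)   ≈⟨ Q.+-cong (Q.*-identityˡ (1# - e)) (mod-‿- 𝔞 e[1-e]≡0) ⟩
      (1# - e) - 0#                  ≈⟨ Q.+-congˡ -0#≈0# ⟩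
      (1# - e) + 0#                  ≈⟨ Q.+-identityʳ (1# - e) ⟩
      1# - e                         ∎
    where
      module Q = CommutativeRing (quotient 𝔞)
      open RingProperties Q.ring using ([y-z]x≈yx-zx; -0#≈0#)
      open ≈-Reasoning Q.setoid
      e[1-e]≡0 : (e * (1# - e)) ≡ 0# mod 𝔞
      e[1-e]≡0 = ∈⇒≡0 𝔞 (resp 𝔞 (*-comm (1# - e) e) (idempotent-orthogonal 𝔞 ee))

  ↑-∈^ : ∀ 𝔞 {x} → x ∈ member 𝔞 → ∀ j → x ↑ j ∈ member (𝔞 ^ j)
  ↑-∈^ 𝔞 x∈ zero    = generator tt
  ↑-∈^ 𝔞 x∈ (suc j) = generator (_ , _ , x∈ , ↑-∈^ 𝔞 x∈ j , refl)

  -- For positive `j`, idempotency makes `e` congruent to its own `j`-th power, which lies in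
  -- `𝔞 ^ j`.
  idempotent-∈^ : ∀ 𝔞 {e} → e ∈ member 𝔞 → ∀ j → Idempotent (𝔞 ^ j) e → e ∈ member (𝔞 ^ j)
  idempotent-∈^ 𝔞 e∈ zero    ee = generator tt
  idempotent-∈^ 𝔞 e∈ (suc j) ee = ≡0⇒∈ (𝔞 ^ suc j) (mod-trans (𝔞 ^ suc j)
    (mod-sym (𝔞 ^ suc j) (idempotent-↑ (𝔞 ^ suc j) ee j)) (∈⇒≡0 (𝔞 ^ suc j) (↑-∈^ 𝔞 e∈ (suc j))))

  ·-⊆ˡ : ∀ 𝔞 𝔟 → member (𝔞 · 𝔟) ⊆ member 𝔞
  ·-⊆ˡ 𝔞 𝔟 (generator (a , b , a∈ , b∈ , e)) = resp 𝔞 (sym e) (*-closedʳ 𝔞 a∈ b)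
  ·-⊆ˡ 𝔞 𝔟 zeroᵍ        = 0-member 𝔞
  ·-⊆ˡ 𝔞 𝔟 (plusᵍ p q)  = +-closed 𝔞 (·-⊆ˡ 𝔞 𝔟 p) (·-⊆ˡ 𝔞 𝔟 q)
  ·-⊆ˡ 𝔞 𝔟 (timesᵍ r p) = *-closed 𝔞 r (·-⊆ˡ 𝔞 𝔟 p)
  ·-⊆ˡ 𝔞 𝔟 (respᵍ e p)  = resp 𝔞 e (·-⊆ˡ 𝔞 𝔟 p)

  ·-mono : ∀ {𝔞 𝔟 𝔞′ 𝔟′} → member 𝔞 ⊆ member 𝔞′ → member 𝔟 ⊆ member 𝔟′ →
           member (𝔞 · 𝔟) ⊆ member (𝔞′ · 𝔟′)
  ·-mono {𝔞} {𝔟} {𝔞′} {𝔟′} f g (generator (a , b , a∈ , b∈ , e)) = generator (a , b , f a∈ , g b∈ , e)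
  ·-mono f g zeroᵍ        = zeroᵍ
  ·-mono {𝔞} {𝔟} {𝔞′} {𝔟′} f g (plusᵍ p q)  = plusᵍ (·-mono {𝔞} {𝔟} {𝔞′} {𝔟′} f g p) (·-mono {𝔞} {𝔟} {𝔞′} {𝔟′} f g q)
  ·-mono {𝔞} {𝔟} {𝔞′} {𝔟′} f g (timesᵍ r p) = timesᵍ r (·-mono {𝔞} {𝔟} {𝔞′} {𝔟′} f g p)
  ·-mono {𝔞} {𝔟} {𝔞′} {𝔟′} f g (respᵍ e p)  = respᵍ e (·-mono {𝔞} {𝔟} {𝔞′} {𝔟′} f g p)

  ^-mono : ∀ {𝔞 𝔟} → member 𝔞 ⊆ member 𝔟 → ∀ j → member (𝔞 ^ j) ⊆ member (𝔟 ^ j)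
  ^-mono f zero    = λ p → p
  ^-mono {𝔞} {𝔟} f (suc j) = ·-mono {𝔞} {𝔞 ^ j} {𝔟} {𝔟 ^ j} f (^-mono {𝔞} {𝔟} f j)

  module _ (𝔭 : NonZeroPrime) where
    open NonZeroPrime 𝔭 using (proper; prime) renaming (ideal to P)

    ↑∈⇒∈ : ∀ {x} m → x ↑ m ∈ member P → x ∈ member P
    ↑∈⇒∈ zero    1∈ = contradiction 1∈ proper
    ↑∈⇒∈ (suc m) x∈ = [ (λ p → p) , ↑∈⇒∈ m ]′ (prime x∈)

  -̂_ : R̂ₚₜ → R̂ₚₜ
  -̂ x = record
    { at       = λ 𝔞 → - at x 𝔞
    ; coherent = λ 𝔞 𝔟 𝔞⊆𝔟 → mod-‿- (ideal 𝔟) (coherent x 𝔞 𝔟 𝔞⊆𝔟) }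

  _*̂_ : R̂ₚₜ → R̂ₚₜ → R̂ₚₜ
  x *̂ y = record
    { at       = λ 𝔞 → at x 𝔞 * at y 𝔞
    ; coherent = λ 𝔞 𝔟 𝔞⊆𝔟 → mod-* (ideal 𝔟) (coherent x 𝔞 𝔟 𝔞⊆𝔟) (coherent y 𝔞 𝔟 𝔞⊆𝔟) }

  FiniteQuotients : Set₁
  FiniteQuotients = ∀ 𝔞 → ∃ λ n → HasCard (R/ ideal 𝔞) U n

  module Splitting (finite : FiniteQuotients) (β : Carrier) where

    exponent : NonZeroIdeal → ℕ
    exponent 𝔞 = proj₁ (idempotent-power (ideal 𝔞) (proj₂ (finite 𝔞)) β)

    -- The exponent is positive, which puts `ε 𝔞` into every ideal that contains β.
    ε : NonZeroIdeal → Carrier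
    ε 𝔞 = β ↑ suc (exponent 𝔞)

    ε-idempotent : ∀ 𝔞 → Idempotent (ideal 𝔞) (ε 𝔞)
    ε-idempotent 𝔞 = proj₂ (idempotent-power (ideal 𝔞) (proj₂ (finite 𝔞)) β)

    -- Idempotents do not change under positive powers, so modulo `𝔟` both sides equal the power of
    -- β whose exponent is the product of theirs.
    ε-coherent : ∀ 𝔞 𝔟 → 𝔞 ⊑ 𝔟 → ε 𝔞 ≡ ε 𝔟 mod ideal 𝔟
    ε-coherent 𝔞 𝔟 𝔞⊆𝔟 = begin
        ε 𝔞                ≈⟨ idempotent-↑ (ideal 𝔟) (𝔞⊆𝔟 (ε-idempotent 𝔞)) n ⟨
        ε 𝔞 ↑ suc n        ≈⟨ mod-refl (ideal 𝔟) (^-assocʳ β (suc m) (suc n)) ⟩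
        β ↑ (suc m ℕ.* suc n)  ≡⟨ ≡.cong (β ↑_) (ℕ.*-comm (suc m) (suc n)) ⟩
        β ↑ (suc n ℕ.* suc m)  ≈⟨ mod-refl (ideal 𝔟) (^-assocʳ β (suc n) (suc m)) ⟨
        ε 𝔟 ↑ suc m        ≈⟨ idempotent-↑ (ideal 𝔟) (ε-idempotent 𝔟) m ⟩
        ε 𝔟                ∎
      where
        m = exponent 𝔞
        n = exponent 𝔟
        open ≈-Reasoning (R/ ideal 𝔟)

    -- The idempotent of R̂ that is 1 at the primes containing β and 0 at the others.
    δ : R̂ₚₜ
    δ = record
      { at       = λ 𝔞 → 1# - ε 𝔞
      ; coherent = λ 𝔞 𝔟 𝔞⊆𝔟 → mod-+ (ideal 𝔟) (mod-refl (ideal 𝔟) refl)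
                     (mod-‿- (ideal 𝔟) (ε-coherent 𝔞 𝔟 𝔞⊆𝔟)) }

    ε∈⇒δ≡1 : ∀ 𝔞 → ε 𝔞 ∈ member (ideal 𝔞) → at δ 𝔞 ≡ 1# mod ideal 𝔞
    ε∈⇒δ≡1 𝔞 ε∈ = begin
        1# - ε 𝔞   ≈⟨ Q.+-congˡ (mod-‿- (ideal 𝔞) (∈⇒≡0 (ideal 𝔞) ε∈)) ⟩
        1# - 0#    ≈⟨ Q.+-congˡ -0#≈0# ⟩
        1# + 0#    ≈⟨ Q.+-identityʳ 1# ⟩
        1#         ∎
      where
        module Q = CommutativeRing (quotient (ideal 𝔞))
        open RingProperties Q.ring using (-0#≈0#)
        open ≈-Reasoning Q.setoid

    β∈⇒ε∈ : ∀ (𝔞 : Ideal) 𝔟 → β ∈ member 𝔞 → ε 𝔟 ∈ member 𝔞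
    β∈⇒ε∈ 𝔞 𝔟 β∈ = *-closedʳ 𝔞 β∈ _

    δ≡1-at : ∀ 𝔭 → β ∈ member (NonZeroPrime.ideal 𝔭) → ∀ j →
             at δ (primePower 𝔭 j) ≡ 1# mod (NonZeroPrime.ideal 𝔭 ^ j)
    δ≡1-at 𝔭 β∈ j = ε∈⇒δ≡1 𝔮 (idempotent-∈^ P (β∈⇒ε∈ P 𝔮 β∈) j (ε-idempotent 𝔮))
      where
        𝔮 = primePower 𝔭 j
        P = NonZeroPrime.ideal 𝔭

    -- No power of β lies in the prime 𝔭, so (1 - ε) ε ∈ 𝔭 forces 1 - ε ∈ 𝔭; being idempotent modulo
    -- `𝔭 ^ j`, it then lies in `𝔭 ^ j`. Modulo `𝔭 ^ 0`, the unit ideal, all elements are congruent.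
    δ≡0-at : ∀ 𝔭 → ¬ β ∈ member (NonZeroPrime.ideal 𝔭) → ∀ j →
             at δ (primePower 𝔭 j) ≡ 0# mod (NonZeroPrime.ideal 𝔭 ^ j)
    δ≡0-at 𝔭 β∉ zero      = generator tt
    δ≡0-at 𝔭 β∉ j@(suc i) = ∈⇒≡0 (P ^ j) (idempotent-∈^ P δ∈P j (complement-idempotent (P ^ j) (ε-idempotent 𝔮)))
      where
        𝔮 = primePower 𝔭 j
        P = NonZeroPrime.ideal 𝔭
        δ∈P : at δ 𝔮 ∈ member P
        δ∈P = [ (λ p → p) , (λ ε∈P → contradiction (↑∈⇒∈ 𝔭 (suc (exponent 𝔮)) ε∈P) β∉) ]′
          (NonZeroPrime.prime 𝔭 (·-⊆ˡ P (P ^ i) (idempotent-orthogonal (P ^ j) (ε-idempotent 𝔮))))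

  -- Compactness and local conditions

  whole : NonZeroIdeal
  whole = record { ideal = unitIdeal ; nonZero = 1# , generator tt , 1≉0 }

  ⋂ : ∀ {ℓ} {I : Set ℓ} → (I → NonZeroIdeal) → List I → NonZeroIdeal
  ⋂ 𝔞 []       = whole
  ⋂ 𝔞 (i ∷ is) = 𝔞 i ⊓ ⋂ 𝔞 is

  ⋂-⊑ : ∀ {ℓ} {I : Set ℓ} (𝔞 : I → NonZeroIdeal) {i is} → i ∈ˡ is → ⋂ 𝔞 is ⊑ 𝔞 i
  ⋂-⊑ 𝔞 (here ≡.refl) (p , _) = p
  ⋂-⊑ 𝔞 (there i∈)    (_ , p) = ⋂-⊑ 𝔞 i∈ p

  near-⋂ : ∀ {ℓ} {I : Set ℓ} (𝔞 : I → NonZeroIdeal) {i is x y} → i ∈ˡ is → nearᴿ (⋂ 𝔞 is) x y → nearᴿ (𝔞 i) x y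
  near-⋂ 𝔞 {i} {is} {x} {y} i∈ = near-⊆ (⋂ 𝔞 is) (𝔞 i) (⋂-⊑ 𝔞 i∈) {x} {y}

  principal : ∀ {x} → ¬ x ≈ 0# → NonZeroIdeal
  principal {x} x≉0 = record { ideal = ⟨ (x ≈_) ⟩ ; nonZero = x , generator refl , x≉0 }

  principal-⊆ : ∀ {x} (x≉0 : ¬ x ≈ 0#) (𝔞 : Ideal) → x ∈ member 𝔞 → member (ideal (principal x≉0)) ⊆ member 𝔞
  principal-⊆ x≉0 𝔞 x∈ (generator e)  = resp 𝔞 e x∈
  principal-⊆ x≉0 𝔞 x∈ zeroᵍ          = 0-member 𝔞
  principal-⊆ x≉0 𝔞 x∈ (plusᵍ p q)    = +-closed 𝔞 (principal-⊆ x≉0 𝔞 x∈ p) (principal-⊆ x≉0 𝔞 x∈ q)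
  principal-⊆ x≉0 𝔞 x∈ (timesᵍ r p)   = *-closed 𝔞 r (principal-⊆ x≉0 𝔞 x∈ p)
  principal-⊆ x≉0 𝔞 x∈ (respᵍ e p)    = resp 𝔞 e (principal-⊆ x≉0 𝔞 x∈ p)

  infixl 6 _-̂_
  _-̂_ : R̂ₚₜ → R̂ₚₜ → R̂ₚₜ
  x -̂ y = x +̂ (-̂ y)

  module _ where
    open ≈-Reasoning setoid

    +-[-]-cancel : ∀ w a b → (w + (a - b)) + (b - a) ≈ w
    +-[-]-cancel w a b = begin
      (w + (a - b)) + (b - a)   ≈⟨ +-assoc w (a - b) (b - a) ⟩
      w + ((a - b) + (b - a))   ≈⟨ +-congˡ (+-congˡ (⁻¹-anti-homo‿- a b)) ⟨
      w + ((a - b) - (a - b))   ≈⟨ +-congˡ (-‿inverseʳ (a - b)) ⟩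
      w + 0#                    ≈⟨ +-identityʳ w ⟩
      w                         ∎
      where open AbelianGroupProperties +-abelianGroup using (⁻¹-anti-homo‿-)

    +-[-]-replace : ∀ a b → a + (b - a) ≈ b
    +-[-]-replace a b = begin
      a + (b - a)    ≈⟨ +-congˡ (+-comm b (- a)) ⟩
      a + (- a + b)  ≈⟨ +-assoc a (- a) b ⟨
      (a - a) + b    ≈⟨ +-congʳ (-‿inverseʳ a) ⟩
      0# + b         ≈⟨ +-identityˡ b ⟩
      b              ∎

  -- Points are families of representatives, and equal points are those congruent modulo every
  -- ideal. Arbitrary subsets may distinguish them, but an open set contains a ball around each of
  -- its points.
  Open-resp : ∀ {W : Subset} → Openᴿ W → ∀ x y → (∀ 𝔞 → nearᴿ 𝔞 x y) → x ∈ W → y ∈ W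
  Open-resp W-open x y x~y x∈W = proj₂ (W-open x x∈W) y (x~y (proj₁ (W-open x x∈W)))

  Compact-resp : ∀ {K L : Subset} → K ≐ L → Compactᴿ K → Compactᴿ L
  Compact-resp (K⊆L , L⊆K) K-compact V V-open covers =
    let (is , p) = K-compact V V-open (λ x∈K → covers (K⊆L x∈K)) in is , λ x∈L → p (L⊆K x∈L)

  Total : Subset
  Total _ = ⊤

  -- Written as the thickening of a single point, so that `_∩thicken[_,_]` also provides the
  -- intersections of compact open sets with balls.
  ball : R̂ₚₜ → NonZeroIdeal → Subset
  ball x = thicken (x ≡_)

  const : Carrier → R̂ₚₜ
  const r = record { at = λ _ → r ; coherent = λ _ 𝔟 _ → mod-refl (ideal 𝔟) refl }

  -- A non-empty compact open set contains a ball, finitely many translates of which cover R̂.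
  compact-total : FiniteQuotients → (V : CompactOpen) → ∃ (_∈ set V) → Compactᴿ Total
  compact-total finite V (x₀ , x₀∈V) {I} W W-open covers =
      concat (tabulate λ j → proj₁ (part j)) , λ {w} _ → found w
    where
      𝔟 = proj₁ (open′ V x₀ x₀∈V)
      open Enumeration (R/ ideal 𝔟) (proj₂ (finite 𝔟))
      ball-compact : Compactᴿ (ball x₀ 𝔟)
      ball-compact = Compact-resp
        ( proj₂
        , λ { {y} x~y@(_ , ≡.refl , near) → proj₂ (open′ V x₀ x₀∈V) y near , x~y })
        (compact (V ∩thicken[ (x₀ ≡_) , 𝔟 ]))
      shift : Fin (proj₁ (finite 𝔟)) → R̂ₚₜ
      shift j = const (element j) -̂ x₀
      -- The ball is covered by the preimages of the `W i` under translation by `shift j`, which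
      -- moves `x₀` to `element j`.
      part : ∀ j → ∃ λ (is : List I) → ball x₀ 𝔟 ⊆ (λ x → Any (λ i → (x +̂ shift j) ∈ W i) is)
      part j = ball-compact (λ i x → (x +̂ shift j) ∈ W i)
        (λ i x x∈ → let (𝔠 , p) = W-open i (x +̂ shift j) x∈ in
          𝔠 , λ y x~y → p (y +̂ shift j) (mod-+ (ideal 𝔠) x~y (mod-refl (ideal 𝔠) refl)))
        (λ _ → covers _)
      found : ∀ w → Any (λ i → w ∈ W i) (concat (tabulate λ j → proj₁ (part j)))
      found w = Any.concat⁺ (Any.tabulate⁺ j (Any.map
          (λ {i} → Open-resp (W-open i) (w′ +̂ shift j) w λ 𝔞 → mod-refl (ideal 𝔞)
            (+-[-]-cancel (at w 𝔞) (at x₀ 𝔞) (element j)))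
          (proj₂ (part j) {w′} (x₀ , ≡.refl , x₀~))))
        where
          j = index (at w 𝔟) tt
          -- The opposite translation carries `w` into the ball around `x₀`.
          w′ = w +̂ (x₀ -̂ const (element j))
          x₀~ : nearᴿ 𝔟 x₀ w′
          x₀~ = mod-trans (ideal 𝔟)
            (mod-refl (ideal 𝔟) (sym (+-[-]-replace (element j) (at x₀ 𝔟))))
            (mod-+ (ideal 𝔟) (element-index (at w 𝔟) tt) (mod-refl (ideal 𝔟) refl))

  Uniform : Subset → NonZeroIdeal → Set₁
  Uniform W 𝔟 = ∀ x y → nearᴿ 𝔟 x y → x ∈ W → y ∈ W

  -- Finitely many balls inside `W` cover it. Each is a union of classes modulo its radius, hence
  -- also modulo the intersection of these radii.
  compact-open⇒uniform : ∀ {W} → Compactᴿ W → Openᴿ W → ∃ (Uniform W)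
  compact-open⇒uniform {W} W-compact W-open = ⋂ radius is , λ x y x~y x∈W → move {x} {y} x~y (within x∈W)
    where
      radius : ∃ (_∈ W) → NonZeroIdeal
      radius (x , x∈W) = proj₁ (W-open x x∈W)
      finite = W-compact {∃ (_∈ W)} (λ c → ball (proj₁ c) (radius c))
        (λ c → thicken-open (proj₁ c ≡_) (radius c))
        (λ {x} x∈W → (x , x∈W) , x , ≡.refl , mod-refl (ideal (radius (x , x∈W))) refl)
      is = proj₁ finite
      within : W ⊆ (λ x → Any (λ c → x ∈ ball (proj₁ c) (radius c)) is)
      within = proj₂ finite
      go : ∀ {x y} (c : ∃ (_∈ W)) → nearᴿ (radius c) x y → x ∈ ball (proj₁ c) (radius c) → y ∈ W
      go {x} {y} c@(z , z∈W) x~y (_ , ≡.refl , z~x) =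
        proj₂ (W-open z z∈W) y (mod-trans (ideal (radius c)) z~x x~y)
      move : ∀ {x y} → nearᴿ (⋂ radius is) x y → Any (λ c → x ∈ ball (proj₁ c) (radius c)) is → y ∈ W
      move {x} {y} x~y any with find any
      ... | c , c∈ , x∈ = go {x} {y} c (near-⋂ radius {x = x} {y} c∈ x~y) x∈

  module LocalConditions {k} (f : Fin k → List Carrier) (X : Subset^ k) where

    component : ∀ 𝔭 → R̂ₚₜ → Fin k → Space.Point R̂₍ 𝔭 ₎
    component 𝔭 x i = π^∞ 𝔭 (evalᴿ (f i) x)

    E : NonZeroPrime → Subset
    E 𝔭 x = component 𝔭 x ∈ local X 𝔭

    private
      P : NonZeroPrime → Ideal
      P = NonZeroPrime.ideal

    -- Polynomials respect congruences, so the condition at 𝔭 survives any change of the point at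
    -- other primes.
    E-resp : ∀ 𝔭 x y → (∀ j → nearᴿ (primePower 𝔭 j) x y) → x ∈ E 𝔭 → y ∈ E 𝔭
    E-resp 𝔭 x y x~y x∈E s = let (z , z∈ , fx~z) = x∈E s in
      z , z∈ , λ i → mod-trans (P 𝔭 ^ s i) (eval-mod (P 𝔭 ^ s i) (f i) (mod-sym (P 𝔭 ^ s i) (x~y (s i)))) (fx~z i)

    E-open : (∀ 𝔭 → Space.Open (R̂₍ 𝔭 ₎ ^ₛ k) (local X 𝔭)) → ∀ 𝔭 → Openᴿ (E 𝔭)
    E-open local-open 𝔭 x x∈E = let (s , p) = local-open 𝔭 (component 𝔭 x) x∈E in
      ⋂ (λ i → primePower 𝔭 (s i)) (allFin k) , λ y x~y → p (component 𝔭 y) λ i →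
        eval-mod (P 𝔭 ^ s i) (f i) (near-⋂ (λ i → primePower 𝔭 (s i)) {x = x} {y} (∈-allFin i) x~y)

    E-closed : ∀ 𝔭 → Openᴿ (∁ (E 𝔭))
    E-closed 𝔭 x x∉E with lem _ {∃ λ s → ¬ ∃ λ z → z ∈ image X 𝔭 ×
                                   (∀ i → Space.near R̂₍ 𝔭 ₎ (s i) (component 𝔭 x i) (z i))}
    ... | no ∄  = contradiction (λ s → decidable-stable (lem _) λ ¬z → ∄ (s , ¬z)) x∉E
    ... | yes (s , ¬z) = ⋂ (λ i → primePower 𝔭 (s i)) (allFin k) , λ y x~y y∈E →
      let (z , z∈ , fy~z) = y∈E s in ¬z (z , z∈ , λ i → mod-trans (P 𝔭 ^ s i)
        (eval-mod (P 𝔭 ^ s i) (f i) (near-⋂ (λ i → primePower 𝔭 (s i)) {x = x} {y} (∈-allFin i) x~y)) (fy~z i))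

    -- Primes with the same elements may differ as records; this carries the condition from one to
    -- the other. The inclusion passes to powers, so a point of `X` that is close at 𝔭 is close at
    -- 𝔮.
    E-⊆ : ∀ 𝔭 𝔮 → member (P 𝔭) ⊆ member (P 𝔮) → E 𝔭 ⊆ E 𝔮
    E-⊆ 𝔭 𝔮 𝔭⊆𝔮 {x} x∈E s = let (z , (x′ , x′∈X , z~x′) , fx~z) = x∈E s in
      (λ i → π^∞ 𝔮 (x′ i)) , (x′ , x′∈X , λ j i → mod-refl (P 𝔮 ^ j i) refl) , λ i →
        near-⊆ (primePower 𝔭 (s i)) (primePower 𝔮 (s i)) (^-mono {P 𝔭} {P 𝔮} 𝔭⊆𝔮 (s i))
          {evalᴿ (f i) x} {x′ i} (mod-trans (P 𝔭 ^ s i) (fx~z i) (z~x′ s i))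

    T : Carrier → Subset
    T β x = ∀ 𝔭 → β ∈ member (P 𝔭) → x ∈ E 𝔭

    T-closed : ∀ β → Openᴿ (∁ (T β))
    T-closed β x x∉T with lem _ {∃ λ 𝔭 → β ∈ member (P 𝔭) × x ∉ E 𝔭}
    ... | no ∄ = contradiction (λ 𝔭 β∈ → decidable-stable (lem _) λ x∉E → ∄ (𝔭 , β∈ , x∉E)) x∉T
    ... | yes (𝔭 , β∈ , x∉E) = let (𝔠 , p) = E-closed 𝔭 x x∉E in 𝔠 , λ y x~y y∈T → p y x~y (y∈T 𝔭 β∈)

    -- A prime containing β is determined by the residue classes modulo β that it
    -- contains, so there are only finitely many of them.
    T-open : (∀ 𝔭 → Space.Open (R̂₍ 𝔭 ₎ ^ₛ k) (local X 𝔭)) → FiniteQuotients →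
             ∀ {β} → ¬ β ≈ 0# → Openᴿ (T β)
    T-open local-open finite {β} β≉0 x x∈T =
        ⋂ radius (allFin (2 ℕ.^ N)) , λ y x~y 𝔭 β∈ →
          proj₂ (near-x (signature 𝔭)) y (near-⋂ radius {x = x} {y} (∈-allFin (signature 𝔭)) x~y) 𝔭 β∈ ≡.refl
      where
        𝔟 = principal β≉0
        N = proj₁ (finite 𝔟)
        open Enumeration (R/ ideal 𝔟) (proj₂ (finite 𝔟))

        -- A number rather than a predicate, so that all possible signatures form a finite list.
        signature : NonZeroPrime → Fin (2 ℕ.^ N)
        signature 𝔭 = funToFin λ i → indicator (lem _ {element i ∈ member (P 𝔭)})

        signature-⊆ : ∀ 𝔭 𝔮 → β ∈ member (P 𝔭) → β ∈ member (P 𝔮) →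
                      signature 𝔭 ≡ signature 𝔮 → member (P 𝔭) ⊆ member (P 𝔮)
        signature-⊆ 𝔭 𝔮 β∈𝔭 β∈𝔮 same {r} r∈ = ≡0⇒∈ (P 𝔮) (mod-trans (P 𝔮)
            (mod-sym (P 𝔮) (principal-⊆ β≉0 (P 𝔮) β∈𝔮 (element-index r tt)))
            (∈⇒≡0 (P 𝔮) (indicator-≡ (lem _) (lem _)
              (≡.trans (≡.sym (finToFun-funToFin (λ i → indicator (lem _ {element i ∈ member (P 𝔭)})) i))
                (≡.trans (≡.cong (λ σ → finToFun {2} {N} σ i) same)
                  (finToFun-funToFin (λ i → indicator (lem _ {element i ∈ member (P 𝔮)})) i)))
              (≡0⇒∈ (P 𝔭) (mod-trans (P 𝔭) (principal-⊆ β≉0 (P 𝔭) β∈𝔭 (element-index r tt))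
                (∈⇒≡0 (P 𝔭) r∈))))))
          where i = index r tt

        -- One prime with signature `σ` stands for all of them; if there is none, the condition is
        -- void and any ideal will do.
        near-x : ∀ σ → ∃ λ 𝔠 → ∀ y → nearᴿ 𝔠 x y → ∀ 𝔭 → β ∈ member (P 𝔭) → signature 𝔭 ≡ σ → y ∈ E 𝔭
        near-x σ with lem _ {∃ λ 𝔭 → β ∈ member (P 𝔭) × signature 𝔭 ≡ σ}
        ... | no ∄ = whole , λ y _ 𝔭 β∈ e → contradiction (𝔭 , β∈ , e) ∄
        ... | yes (𝔮 , β∈𝔮 , e𝔮) = let (𝔠 , p) = E-open local-open 𝔮 x (x∈T 𝔮 β∈𝔮) in
          𝔠 , λ y x~y 𝔭 β∈ e → E-⊆ 𝔮 𝔭 (signature-⊆ 𝔮 𝔭 β∈𝔮 β∈ (≡.trans e𝔮 (≡.sym e))) {y} (p y x~y)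

        radius : Fin (2 ℕ.^ N) → NonZeroIdeal
        radius σ = proj₁ (near-x σ)

  -- Measures

  module _ {p} (𝔞 : Ideal) (P : Pred Carrier p) where

    card-hasCard : ∃ (HasCard (R/ 𝔞) P) → HasCard (R/ 𝔞) P (card 𝔞 P)
    card-hasCard h with lem _ {∃ (HasCard (R/ 𝔞) P)}
    ... | yes (_ , h′) = h′
    ... | no ∄         = contradiction h ∄

    card-infinite : ¬ ∃ (HasCard (R/ 𝔞) P) → card 𝔞 P ≡ 0
    card-infinite ∄ with lem _ {∃ (HasCard (R/ 𝔞) P)}
    ... | yes h = contradiction h ∄
    ... | no _  = ≡.refl

  hasCard-residues : FiniteQuotients → ∀ Z 𝔞 → ∃ (HasCard (R/ ideal 𝔞) (residues Z 𝔞))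
  hasCard-residues finite Z 𝔞 = covered⇒hasCard (R/ ideal 𝔞) lem (residues Z 𝔞) element
      λ r _ → index r tt , element-index r tt
    where open Enumeration (R/ ideal 𝔞) (proj₂ (finite 𝔞))

  hasCard-quotient : ∀ 𝔞 𝔟 → 𝔞 ⊑ 𝔟 → ∃ (HasCard (R/ ideal 𝔞) U) → ∃ (HasCard (R/ ideal 𝔟) U)
  hasCard-quotient 𝔞 𝔟 𝔞⊑𝔟 (n , h) = covered⇒hasCard (R/ ideal 𝔟) lem U element
      λ r _ → index r tt , 𝔞⊑𝔟 (element-index r tt)
    where open Enumeration (R/ ideal 𝔞) h

  hasCard≢0 : ∀ {p} {P : Pred Carrier p} 𝔞 {n} → HasCard (R/ 𝔞) P n → ∃ (_∈ P) → ¬ n ≡ 0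
  hasCard≢0 𝔞 h (x , x∈P) ≡.refl with () ← Enumeration.index (R/ 𝔞) h x x∈P

  module Counting (μ : Distribution) where

    empty⇒0 : ∀ V → Empty (set V) → ⟪ μ ⟫ V ≈ᵣ 0ᵣ
    empty⇒0 V V-empty = ≈+self⇒≈0 (additive μ V V V
      (inj₁ , [ (λ x∈ → x∈) , (λ x∈ → x∈) ]′) λ x (x∈ , _) → V-empty x x∈)

    -- Finite additivity by induction: the class of `y zero` is split off, and the part of `Y` in
    -- the other classes is again compact open.
    count : ∀ {n} 𝔠 (Y : CompactOpen) (y : Fin n → R̂ₚₜ) → (∀ i j → nearᴿ 𝔠 (y i) (y j) → i ≡ j) →
            (∀ x → x ∈ set Y → ∃ λ i → nearᴿ 𝔠 (y i) x) →
            ∀ g → (∀ i → ⟪ μ ⟫ (Y ∩thicken[ (y i ≡_) , 𝔠 ]) ≈ᵣ g) → ⟪ μ ⟫ Y ≈ᵣ ι n ⋆ g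
    count {zero} 𝔠 Y y distinct covers g pieces = ≈ᵣ-trans
      (empty⇒0 Y λ x x∈ → case₀ {x} (covers x x∈)) (≈ᵣ-sym (⋆-zeroˡ g))
      where
        case₀ : ∀ {x} → ¬ ∃ λ (i : Fin 0) → nearᴿ 𝔠 (y i) x
        case₀ ()
    count {suc n} 𝔠 Y y distinct covers g pieces = begin
        ⟪ μ ⟫ Y                    ≈⟨ additive μ Y₀ Y⁺ Y (split , join) disjoint ⟩
        ⟪ μ ⟫ Y₀ +ᵣ ⟪ μ ⟫ Y⁺       ≈⟨ +ᵣ-cong (pieces zero) (count 𝔠 Y⁺ (y ∘ suc)
                                        (λ i j e → suc-injective (distinct (suc i) (suc j) e)) covers⁺ g pieces⁺) ⟩
        g +ᵣ ι n ⋆ g               ≈⟨ ι-suc-⋆ n g ⟨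
        ι (suc n) ⋆ g              ∎
      where
        open ≈-Reasoning ℝ-setoid
        Rest : Subset
        Rest z = ∃ λ i → y (suc i) ≡ z
        Y₀ Y⁺ : CompactOpen
        Y₀ = Y ∩thicken[ (y zero ≡_) , 𝔠 ]
        Y⁺ = Y ∩thicken[ Rest , 𝔠 ]
        split : set Y ⊆ set Y₀ ∪ set Y⁺
        split {x} x∈ with covers x x∈
        ... | zero , e  = inj₁ (x∈ , y zero , ≡.refl , e)
        ... | suc i , e = inj₂ (x∈ , y (suc i) , (i , ≡.refl) , e)
        join : set Y₀ ∪ set Y⁺ ⊆ set Y
        join = [ proj₁ , proj₁ ]′
        disjoint : Empty (set Y₀ ∩ set Y⁺)
        disjoint x ((_ , _ , ≡.refl , e) , (_ , _ , (i , ≡.refl) , e′)) =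
          0≢1+n (distinct zero (suc i) (mod-trans (ideal 𝔠) e (mod-sym (ideal 𝔠) e′)))
        covers⁺ : ∀ x → x ∈ set Y⁺ → ∃ λ i → nearᴿ 𝔠 (y (suc i)) x
        covers⁺ x (_ , _ , (i , ≡.refl) , e) = i , e
        pieces⁺ : ∀ i → ⟪ μ ⟫ (Y⁺ ∩thicken[ (y (suc i) ≡_) , 𝔠 ]) ≈ᵣ g
        pieces⁺ i = ≈ᵣ-trans (Distribution.cong μ _ (Y ∩thicken[ (y (suc i) ≡_) , 𝔠 ])
          ( (λ ((x∈ , _) , b) → x∈ , b)
          , λ { (x∈ , b@(_ , ≡.refl , e)) → (x∈ , _ , (i , ≡.refl) , e) , b }))
          (pieces (suc i))

    -- Each residue class is represented by a point of `Z`, since the pieces are measured at points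
    -- of `Z`.
    count-residues : ∀ 𝔠 (Y : CompactOpen) (Z : Subset) {n} → HasCard (R/ ideal 𝔠) (residues Z 𝔠) n →
                     set Y ⊆ thicken Z 𝔠 →
                     ∀ g → (∀ z → z ∈ Z → ⟪ μ ⟫ (Y ∩thicken[ (z ≡_) , 𝔠 ]) ≈ᵣ g) → ⟪ μ ⟫ Y ≈ᵣ ι n ⋆ g
    count-residues 𝔠 Y Z {n} h Y⊆ g pieces = count 𝔠 Y z distinct covers g λ i → pieces (z i) (proj₁ (proj₂ (element∈ i)))
      where
        open Enumeration (R/ ideal 𝔠) h
        z : Fin n → R̂ₚₜ
        z i = proj₁ (element∈ i)
        z≡ : ∀ i → at (z i) 𝔠 ≡ element i mod ideal 𝔠
        z≡ i = proj₂ (proj₂ (element∈ i))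
        distinct : ∀ i j → nearᴿ 𝔠 (z i) (z j) → i ≡ j
        distinct i j e = element-injective i j
          (mod-trans (ideal 𝔠) (mod-sym (ideal 𝔠) (z≡ i)) (mod-trans (ideal 𝔠) e (z≡ j)))
        covers : ∀ x → x ∈ set Y → ∃ λ i → nearᴿ 𝔠 (z i) x
        covers x x∈ = index (at x 𝔠) (Y⊆ x∈) ,
          mod-trans (ideal 𝔠) (z≡ _) (element-index (at x 𝔠) (Y⊆ x∈))

  -- Equidistribution of the preimage among residue classes

  module Equidistribution
    (μ : Distribution) (haar : IsNormalizedHaar μ) {k} (f : Fin k → List Carrier) (X : Subset^ k)
    (eulerian : OpenlyEulerian X) where

    open LocalConditions f X
    open Counting μ
    open IsNormalizedHaar haar

    S : Subset
    S = preimage f (closure X)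

    S⇒E : ∀ x → x ∈ S → ∀ 𝔭 → x ∈ E 𝔭
    S⇒E x = proj₁ (proj₁ eulerian) {λ i → evalᴿ (f i) x}

    E⇒S : ∀ x → (∀ 𝔭 → x ∈ E 𝔭) → x ∈ S
    E⇒S x = proj₂ (proj₁ eulerian) {λ i → evalᴿ (f i) x}

    -- A point of `V` gives the compactness of R̂; `s₀` fixes a reference class and keeps the
    -- denominators non-zero.
    module NonTrivial (finite : FiniteQuotients) (V : CompactOpen) (V-inhabited : ∃ (_∈ set V)) (s₀ : R̂ₚₜ) (s₀∈S : s₀ ∈ S) where

      total : CompactOpen
      total .set     = Total
      total .open′ _ _ = whole , _
      total .compact = compact-total finite V V-inhabited

      V-uniform : ∃ (Uniform (set V))
      V-uniform = compact-open⇒uniform (compact V) (open′ V)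

      𝔟ⱽ : NonZeroIdeal
      𝔟ⱽ = proj₁ V-uniform

      β : Carrier
      β = proj₁ (nonZero 𝔟ⱽ)

      open Splitting finite β

      T-uniform : ∃ (Uniform (T β))
      T-uniform = compact-open⇒uniform
        (Compact-resp (proj₂ , λ x∈T → _ , x∈T) (∩-compact {Total} {T β} (compact total) (T-closed β)))
        (T-open (proj₂ eulerian) finite (proj₂ (proj₂ (nonZero 𝔟ⱽ))))

      𝔟 : NonZeroIdeal
      𝔟 = 𝔟ⱽ ⊓ proj₁ T-uniform

      -- The colon ideal (𝔟 : 1 - ε).  It allows for congruences modulo 𝔟 only at the primes
      -- containing β, which is all that V and T β depend on.
      𝔡 : NonZeroIdeal
      𝔡 = record
        { ideal = record
          { member   = λ r → at δ 𝔟 * r ∈ member (ideal 𝔟)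
          ; resp     = λ x≈y → resp (ideal 𝔟) (*-congˡ x≈y)
          ; 0-member = resp (ideal 𝔟) (sym (zeroʳ (at δ 𝔟))) (0-member (ideal 𝔟))
          ; +-closed = λ p q → resp (ideal 𝔟) (sym (distribˡ (at δ 𝔟) _ _)) (+-closed (ideal 𝔟) p q)
          ; *-closed = λ r p → resp (ideal 𝔟)
              (trans (sym (*-assoc r (at δ 𝔟) _)) (trans (*-congʳ (*-comm r (at δ 𝔟))) (*-assoc (at δ 𝔟) r _)))
              (*-closed (ideal 𝔟) r p) }
        ; nonZero = let (x , x∈ , x≉0) = nonZero 𝔟 in x , *-closed (ideal 𝔟) (at δ 𝔟) x∈ , x≉0 }

      𝔟⊑𝔡 : 𝔟 ⊑ 𝔡
      𝔟⊑𝔡 = *-closed (ideal 𝔟) (at δ 𝔟)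

      -- The relation (1 - ε) ε ∈ 𝔟 says that ε, taken at `𝔟`, lies in the colon ideal; coherence
      -- transfers this to ε taken at `𝔡`.
      δ≡1-mod-𝔡 : at δ 𝔡 ≡ 1# mod ideal 𝔡
      δ≡1-mod-𝔡 = ε∈⇒δ≡1 𝔡 (≡0⇒∈ (ideal 𝔡) (mod-trans (ideal 𝔡)
        (mod-sym (ideal 𝔡) (ε-coherent 𝔟 𝔡 𝔟⊑𝔡))
        (∈⇒≡0 (ideal 𝔡) (idempotent-orthogonal (ideal 𝔟) (ε-idempotent 𝔟)))))

      δ-near : ∀ x 𝔠 → at δ 𝔠 ≡ 1# mod ideal 𝔠 → nearᴿ 𝔠 (δ *̂ x) x
      δ-near x 𝔠 δ≡1 = mod-trans (ideal 𝔠) (mod-* (ideal 𝔠) δ≡1 (mod-refl (ideal 𝔠) refl))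
        (mod-refl (ideal 𝔠) (*-identityˡ (at x 𝔠)))

      𝔡-near : ∀ x y → nearᴿ 𝔡 x y → nearᴿ 𝔟 (δ *̂ x) (δ *̂ y)
      𝔡-near x y x~y = resp (ideal 𝔟) (x[y-z]≈xy-xz (at δ 𝔟) (at x 𝔟) (at y 𝔟))
          (mod-trans (ideal 𝔡) (coherent x 𝔟 𝔡 𝔟⊑𝔡)
            (mod-trans (ideal 𝔡) x~y (mod-sym (ideal 𝔡) (coherent y 𝔟 𝔡 𝔟⊑𝔡))))
        where open RingProperties ring using (x[y-z]≈xy-xz)

      -- Since β ∈ `𝔟ⱽ`, multiplication by δ changes nothing modulo `𝔟ⱽ`, and it turns congruence
      -- modulo `𝔡` into congruence modulo `𝔟`.
      V-uniform-𝔡 : Uniform (set V) 𝔡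
      V-uniform-𝔡 x y x~y = proj₂ V-uniform x y (mod-trans (ideal 𝔟ⱽ)
          (mod-sym (ideal 𝔟ⱽ) (δ-near x 𝔟ⱽ δ≡1)) (mod-trans (ideal 𝔟ⱽ)
          (near-⊆ 𝔟 𝔟ⱽ proj₁ {δ *̂ x} {δ *̂ y} (𝔡-near x y x~y)) (δ-near y 𝔟ⱽ δ≡1)))
        where δ≡1 = ε∈⇒δ≡1 𝔟ⱽ (β∈⇒ε∈ (ideal 𝔟ⱽ) 𝔟ⱽ (proj₁ (proj₂ (nonZero 𝔟ⱽ))))

      -- `T β` sees only primes containing β, where δ is 1, so `x` and `y` may be replaced by their
      -- multiples by δ.
      T-uniform-𝔡 : Uniform (T β) 𝔡
      T-uniform-𝔡 x y x~y x∈T 𝔭 β∈ = E-resp 𝔭 (δ *̂ y) y (λ j → δ-near y (primePower 𝔭 j) (δ≡1-at 𝔭 β∈ j))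
        (proj₂ T-uniform (δ *̂ x) (δ *̂ y)
          (near-⊆ 𝔟 (proj₁ T-uniform) proj₂ {δ *̂ x} {δ *̂ y} (𝔡-near x y x~y))
          (λ 𝔮 β∈𝔮 → E-resp 𝔮 x (δ *̂ x) (λ j → mod-sym (ideal (primePower 𝔮 j)) (δ-near x (primePower 𝔮 j) (δ≡1-at 𝔮 β∈𝔮 j)))
            (x∈T 𝔮 β∈𝔮))
          𝔭 β∈)

      translation : R̂ₚₜ → R̂ₚₜ → R̂ₚₜ
      translation s s′ = δ *̂ (s′ -̂ s)

      translate-near : ∀ s s′ x → nearᴿ 𝔡 s x → nearᴿ 𝔡 s′ (x +̂ translation s s′)
      translate-near s s′ x s~x = mod-sym (ideal 𝔡) (mod-trans (ideal 𝔡)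
        (mod-+ (ideal 𝔡) (mod-sym (ideal 𝔡) s~x) (δ-near (s′ -̂ s) 𝔡 δ≡1-mod-𝔡))
        (mod-refl (ideal 𝔡) (+-[-]-replace (at s 𝔡) (at s′ 𝔡))))

      -- At primes containing β the condition is inherited from `s′` through its class modulo `𝔡`;
      -- at the others δ is 0 and it is inherited from `t`.
      translate-S : ∀ s s′ t → s′ ∈ S → t ∈ S → nearᴿ 𝔡 s t → (t +̂ translation s s′) ∈ S
      translate-S s s′ t s′∈S t∈S s~t = E⇒S t′ λ 𝔭 → local-condition 𝔭 (lem _)
        where
          t′ : R̂ₚₜ
          t′ = t +̂ translation s s′
          t′∈T : t′ ∈ T β
          t′∈T = T-uniform-𝔡 s′ t′ (translate-near s s′ t s~t) λ 𝔭 _ → S⇒E s′ s′∈S 𝔭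
          local-condition : ∀ 𝔭 → Dec (β ∈ member (NonZeroPrime.ideal 𝔭)) → t′ ∈ E 𝔭
          local-condition 𝔭 (yes β∈) = t′∈T 𝔭 β∈
          local-condition 𝔭 (no β∉)  = E-resp 𝔭 t t′ (λ j → let 𝔮 = NonZeroPrime.ideal 𝔭 ^ j in
            mod-trans 𝔮 (mod-refl 𝔮 (sym (+-identityʳ _))) (mod-+ 𝔮 (mod-refl 𝔮 refl)
              (mod-sym 𝔮 (mod-trans 𝔮 (mod-* 𝔮 (δ≡0-at 𝔭 β∉ j) (mod-refl 𝔮 refl)) (mod-refl 𝔮 (zeroˡ _))))))
            (S⇒E t t∈S 𝔭)

      module Below (𝔞 : NonZeroIdeal) (𝔞⊑𝔡 : 𝔞 ⊑ 𝔡) where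

        Sₐ : CompactOpen
        Sₐ = total ∩thicken[ S , 𝔞 ]

        slice : R̂ₚₜ → CompactOpen
        slice s = Sₐ ∩thicken[ (s ≡_) , 𝔡 ]

        translate-slice : ∀ s s′ x → s′ ∈ S → x ∈ set (slice s) → (x +̂ translation s s′) ∈ set (slice s′)
        translate-slice s s′ x s′∈S ((_ , t , t∈S , t~x) , (_ , ≡.refl , s~x)) =
          -- `x` itself need not lie in `S`; its approximation `t` is translated along with it.
          (_ , t +̂ translation s s′
            , translate-S s s′ t s′∈S t∈S (mod-trans (ideal 𝔡) s~x (mod-sym (ideal 𝔡) (near-⊆ 𝔞 𝔡 𝔞⊑𝔡 {t} {x} t~x)))
            , mod-+ (ideal 𝔞) t~x (mod-refl (ideal 𝔞) refl))
          , (s′ , ≡.refl , translate-near s s′ x s~x)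

        -- Invariance of the measure under the translation from `s` to `s′`, whose inverse is the
        -- translation from `s′` to `s`.
        slices-equal : ∀ s s′ → s ∈ S → s′ ∈ S → ⟪ μ ⟫ (slice s) ≈ᵣ ⟪ μ ⟫ (slice s′)
        slices-equal s s′ s∈S s′∈S = invariant (translation s s′) (slice s) (slice s′) λ x →
          mk⇔ (translate-slice s s′ x s′∈S) λ x+∈ →
            Open-resp (open′ (slice s)) ((x +̂ translation s s′) +̂ translation s′ s) x (back x)
              (translate-slice s′ s (x +̂ translation s s′) s∈S x+∈)
          where
            back : ∀ x 𝔠 → nearᴿ 𝔠 ((x +̂ translation s s′) +̂ translation s′ s) x
            back x 𝔠 = mod-refl (ideal 𝔠) (begin
                (at x 𝔠 + d * (b - a)) + d * (a - b)         ≈⟨ +-cong (+-congˡ (x[y-z]≈xy-xz d b a)) (x[y-z]≈xy-xz d a b) ⟩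
                (at x 𝔠 + (d * b - d * a)) + (d * a - d * b) ≈⟨ +-[-]-cancel (at x 𝔠) (d * b) (d * a) ⟩
                at x 𝔠                                       ∎)
              where
                open RingProperties ring using (x[y-z]≈xy-xz)
                open ≈-Reasoning setoid
                a = at s 𝔠
                b = at s′ 𝔠
                d = at δ 𝔠

        ballₐ : R̂ₚₜ → CompactOpen
        ballₐ x = total ∩thicken[ (x ≡_) , 𝔞 ]

        balls-equal : ∀ x y → ⟪ μ ⟫ (ballₐ x) ≈ᵣ ⟪ μ ⟫ (ballₐ y)
        balls-equal x y = invariant (y -̂ x) (ballₐ x) (ballₐ y) λ z → mk⇔
          (λ { (_ , _ , ≡.refl , x~z) → _ , _ , ≡.refl , mod-trans 𝔞ᵢ
                 (mod-refl 𝔞ᵢ (sym (+-[-]-replace (at x 𝔞) (at y 𝔞)))) (mod-+ 𝔞ᵢ x~z (mod-refl 𝔞ᵢ refl)) })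
          (λ { (_ , _ , ≡.refl , y~z) → _ , _ , ≡.refl , mod-trans 𝔞ᵢ
                 (mod-refl 𝔞ᵢ (sym (+-[-]-replace (at y 𝔞) (at x 𝔞)))) (mod-trans 𝔞ᵢ
                   (mod-+ 𝔞ᵢ y~z (mod-refl 𝔞ᵢ refl))
                   (mod-refl 𝔞ᵢ (+-[-]-cancel (at z 𝔞) (at y 𝔞) (at x 𝔞)))) })
          where 𝔞ᵢ = ideal 𝔞

        module _ {N s p n}
          (N-card : HasCard (R/ ideal 𝔞) U N)
          (s-card : HasCard (R/ ideal 𝔞) (residues S 𝔞) s)
          (p-card : HasCard (R/ ideal 𝔡) (residues S 𝔡) p)
          (n-card : HasCard (R/ ideal 𝔡) (residues (S ∩ set V) 𝔡) n) where

          -- `m` is the measure of any class modulo `𝔞`, and `g` that of the part of `Sₐ` in any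
          -- class modulo `𝔡` that meets `S`.
          m g : ℝ
          m = ⟪ μ ⟫ (ballₐ s₀)
          g = ⟪ μ ⟫ (slice s₀)

          N⋆m≈1 : ι N ⋆ m ≈ᵣ 1ᵣ
          N⋆m≈1 = ≈ᵣ-trans (≈ᵣ-sym (count 𝔞 total (const ∘ element) element-injective
              (λ x _ → index (at x 𝔞) tt , element-index (at x 𝔞) tt) m
              (λ i → balls-equal (const (element i)) s₀)))
              (normalized total _)
            where open Enumeration (R/ ideal 𝔞) N-card

          Sₐ≈s⋆m : ⟪ μ ⟫ Sₐ ≈ᵣ ι s ⋆ m
          Sₐ≈s⋆m = count-residues 𝔞 Sₐ S s-card proj₂ m λ z z∈S → ≈ᵣ-trans
            (Distribution.cong μ (Sₐ ∩thicken[ (z ≡_) , 𝔞 ]) (ballₐ z)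
              ( (λ (_ , b) → _ , b)
              , λ { (_ , b@(_ , ≡.refl , z~x)) → (_ , z , z∈S , z~x) , b }))
            (balls-equal z s₀)

          coarsen : thicken S 𝔞 ⊆ thicken S 𝔡
          coarsen {x} (t , t∈S , t~x) = t , t∈S , near-⊆ 𝔞 𝔡 𝔞⊑𝔡 {t} {x} t~x

          -- The second count of the same set; equating it with the count by classes modulo `𝔞`
          -- links `g` to `m`.
          Sₐ≈p⋆g : ⟪ μ ⟫ Sₐ ≈ᵣ ι p ⋆ g
          Sₐ≈p⋆g = count-residues 𝔡 Sₐ S p-card (λ {x} (_ , x∈) → coarsen {x} x∈) g λ z z∈S → slices-equal z s₀ z∈S s₀∈S

          V∩Sₐ≈n⋆g : ⟪ μ ⟫ (V ∩thicken[ S , 𝔞 ]) ≈ᵣ ι n ⋆ g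
          V∩Sₐ≈n⋆g = count-residues 𝔡 (V ∩thicken[ S , 𝔞 ]) (S ∩ set V) n-card
            -- As `V` is a union of classes modulo `𝔡`, the approximation `t` of `x` lies in `V`
            -- too.
            (λ {x} (x∈V , t , t∈S , t~x) → let t~x′ = near-⊆ 𝔞 𝔡 𝔞⊑𝔡 {t} {x} t~x in
              t , (t∈S , V-uniform-𝔡 x t (mod-sym (ideal 𝔡) t~x′) x∈V) , t~x′)
            g λ z (z∈S , z∈V) → ≈ᵣ-trans
              (Distribution.cong μ ((V ∩thicken[ S , 𝔞 ]) ∩thicken[ (z ≡_) , 𝔡 ]) (slice z)
                ( (λ ((_ , x∈) , b) → (_ , x∈) , b)
                , λ { {x} ((_ , x∈) , b@(_ , ≡.refl , z~x)) → (V-uniform-𝔡 z x z~x z∈V , x∈) , b }))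
              (slices-equal z s₀ z∈S s₀∈S)

          density : (N ÷ s) ⋆ ⟪ μ ⟫ (V ∩thicken[ S , 𝔞 ]) ≈ᵣ fromℚ (n ÷ p)
          density = begin
              (N ÷ s) ⋆ ⟪ μ ⟫ (V ∩thicken[ S , 𝔞 ])  ≈⟨ ⋆-congˡ (N ÷ s) V∩Sₐ≈n⋆g ⟩
              (N ÷ s) ⋆ ι n ⋆ g                      ≡⟨ ≡.cong (λ q → (N ÷ s) ⋆ q ⋆ g) (÷-cancel n p≢0) ⟨
              -- Writing n as (n/p) p allows p g to be exchanged for s m, after which N m = 1
              -- removes all dependence on `𝔞`.
              (N ÷ s) ⋆ ((n ÷ p) ℚ.* ι p) ⋆ g        ≈⟨ ⋆-congˡ (N ÷ s) (⋆-assoc (n ÷ p) (ι p) g) ⟨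
              (N ÷ s) ⋆ (n ÷ p) ⋆ ι p ⋆ g            ≈⟨ ⋆-comm (N ÷ s) (n ÷ p) (ι p ⋆ g) ⟩
              (n ÷ p) ⋆ (N ÷ s) ⋆ ι p ⋆ g            ≈⟨ ⋆-congˡ (n ÷ p) (⋆-congˡ (N ÷ s) (≈ᵣ-trans (≈ᵣ-sym Sₐ≈p⋆g) Sₐ≈s⋆m)) ⟩
              (n ÷ p) ⋆ (N ÷ s) ⋆ ι s ⋆ m            ≈⟨ ⋆-congˡ (n ÷ p) (⋆-assoc (N ÷ s) (ι s) m) ⟩
              (n ÷ p) ⋆ ((N ÷ s) ℚ.* ι s) ⋆ m        ≡⟨ ≡.cong (λ q → (n ÷ p) ⋆ q ⋆ m) (÷-cancel N s≢0) ⟩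
              (n ÷ p) ⋆ ι N ⋆ m                      ≈⟨ ⋆-congˡ (n ÷ p) N⋆m≈1 ⟩
              (n ÷ p) ⋆ 1ᵣ                           ≈⟨ pointwise⇒≈ᵣ (λ _ → ℚ.*-identityʳ (n ÷ p)) ⟩
              fromℚ (n ÷ p)                          ∎
            where
              open ≈-Reasoning ℝ-setoid
              s≢0 : ¬ s ≡ 0
              s≢0 = hasCard≢0 (ideal 𝔞) s-card (at s₀ 𝔞 , s₀ , s₀∈S , mod-refl (ideal 𝔞) refl)
              p≢0 : ¬ p ≡ 0
              p≢0 = hasCard≢0 (ideal 𝔡) p-card (at s₀ 𝔡 , s₀ , s₀∈S , mod-refl (ideal 𝔡) refl)

    -- Construction of the limit

    EventuallyConstant : CompactOpen → Set₁
    EventuallyConstant V = ∃ λ q → ∃ λ 𝔟 → ∀ 𝔞 → 𝔞 ⊑ 𝔟 → μ̃ μ S 𝔞 V ≈ᵣ fromℚ q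

    eventuallyConstant-infinite : ¬ FiniteQuotients → ∀ V → EventuallyConstant V
    eventuallyConstant-infinite ¬finite V =
      let (𝔟 , ¬card) = decidable-stable (lem _ {∃ λ 𝔟 → ¬ ∃ (HasCard (R/ ideal 𝔟) U)})
            λ ∄ → ¬finite λ 𝔟 → decidable-stable (lem _) λ ¬card → ∄ (𝔟 , ¬card)
      -- Ideals inside `𝔟` have infinite residue rings as well, so the numerator of the scaling
      -- factor takes its default value 0.
      in 0ℚ , 𝔟 , λ 𝔞 𝔞⊑𝔟 → ≈ᵣ-trans
      (pointwise⇒≈ᵣ λ i → ≡.cong (ℚ._* seq (⟪ μ ⟫ (V ∩thicken[ S , 𝔞 ])) i)
        (≡.trans (≡.cong (_÷ card (ideal 𝔞) (residues S 𝔞))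
          (card-infinite (ideal 𝔞) U (λ h → ¬card (hasCard-quotient 𝔞 𝔟 𝔞⊑𝔟 h))))
          (0÷ (card (ideal 𝔞) (residues S 𝔞)))))
      (⋆-zeroˡ (⟪ μ ⟫ (V ∩thicken[ S , 𝔞 ])))

    eventuallyConstant-empty : ∀ V → (∀ 𝔞 → Empty (set (V ∩thicken[ S , 𝔞 ]))) → EventuallyConstant V
    eventuallyConstant-empty V empty = 0ℚ , whole , λ 𝔞 _ → ⋆-zeroʳ _ (empty⇒0 (V ∩thicken[ S , 𝔞 ]) (empty 𝔞))

    eventuallyConstant-finite : FiniteQuotients → ∀ V → ∃ (_∈ set V) → ∃ (_∈ S) → EventuallyConstant V
    eventuallyConstant-finite finite V V-inhabited (s₀ , s₀∈S) =
        proj₁ n-card ÷ proj₁ p-card , 𝔡 , λ 𝔞 𝔞⊑𝔡 → Below.density 𝔞 𝔞⊑𝔡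
          (card-hasCard (ideal 𝔞) U (finite 𝔞))
          (card-hasCard (ideal 𝔞) (residues S 𝔞) (hasCard-residues finite S 𝔞))
          (proj₂ p-card) (proj₂ n-card)
      where
        open NonTrivial finite V V-inhabited s₀ s₀∈S
        p-card = hasCard-residues finite S 𝔡
        n-card = hasCard-residues finite (S ∩ set V) 𝔡

    eventuallyConstant : ∀ V → EventuallyConstant V
    eventuallyConstant V = cases (lem _) (lem _) (lem _)
      where
        cases : Dec FiniteQuotients → Dec (∃ (_∈ set V)) → Dec (∃ (_∈ S)) → EventuallyConstant V
        cases (no ¬finite) _         _        = eventuallyConstant-infinite ¬finite V
        cases (yes _)      (no ∄V)   _        = eventuallyConstant-empty V λ 𝔞 x (x∈V , _) → ∄V (x , x∈V)
        cases (yes _)      (yes _)   (no ∄S)  = eventuallyConstant-empty V λ 𝔞 x (_ , t , t∈S , _) → ∄S (t , t∈S)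
        cases (yes finite) (yes ∃V)  (yes ∃S) = eventuallyConstant-finite finite V ∃V ∃S

    -- Each law involves finitely many sets, so it can be checked for the net at an ideal inside all
    -- their stages, where it follows from the law for `μ`.
    procounting : Distribution
    procounting = record
      { ⟪_⟫      = ν
      ; cong     = λ V W V≐W → let 𝔞 = stage V ⊓ stage W in begin
          ν V          ≈⟨ stable V 𝔞 proj₁ ⟨
          μ̃ μ S 𝔞 V   ≈⟨ ⋆-congˡ _ (Distribution.cong μ _ _
                          ( (λ (x∈ , x∈S) → proj₁ V≐W x∈ , x∈S) , (λ (x∈ , x∈S) → proj₂ V≐W x∈ , x∈S))) ⟩
          μ̃ μ S 𝔞 W   ≈⟨ stable W 𝔞 proj₂ ⟩
          ν W          ∎
      ; additive = λ V W Z Z≐V∪W disjoint → let 𝔞 = stage V ⊓ (stage W ⊓ stage Z) in begin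
          ν Z                        ≈⟨ stable Z 𝔞 (λ x∈ → proj₂ (proj₂ x∈)) ⟨
          μ̃ μ S 𝔞 Z                 ≈⟨ ⋆-congˡ (scale 𝔞) (additive μ (V ∩thicken[ S , 𝔞 ]) (W ∩thicken[ S , 𝔞 ]) (Z ∩thicken[ S , 𝔞 ])
              ( (λ (x∈Z , x∈S) → [ (λ x∈V → inj₁ (x∈V , x∈S)) , (λ x∈W → inj₂ (x∈W , x∈S)) ]′ (proj₁ Z≐V∪W x∈Z))
              , [ (λ (x∈V , x∈S) → proj₂ Z≐V∪W (inj₁ x∈V) , x∈S) , (λ (x∈W , x∈S) → proj₂ Z≐V∪W (inj₂ x∈W) , x∈S) ]′)
              λ x ((x∈V , _) , (x∈W , _)) → disjoint x (x∈V , x∈W)) ⟩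
          scale 𝔞 ⋆ (⟪ μ ⟫ (V ∩thicken[ S , 𝔞 ]) +ᵣ ⟪ μ ⟫ (W ∩thicken[ S , 𝔞 ]))
                                     ≈⟨ pointwise⇒≈ᵣ (λ i → ℚ.*-distribˡ-+ (scale 𝔞) (seq (⟪ μ ⟫ (V ∩thicken[ S , 𝔞 ])) i) (seq (⟪ μ ⟫ (W ∩thicken[ S , 𝔞 ])) i)) ⟩
          μ̃ μ S 𝔞 V +ᵣ μ̃ μ S 𝔞 W   ≈⟨ +ᵣ-cong (stable V 𝔞 proj₁) (stable W 𝔞 (λ x∈ → proj₁ (proj₂ x∈))) ⟩
          ν V +ᵣ ν W                 ∎ }
      where
        open ≈-Reasoning ℝ-setoid
        ν : CompactOpen → ℝ
        ν V = fromℚ (proj₁ (eventuallyConstant V))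
        stage : CompactOpen → NonZeroIdeal
        stage V = proj₁ (proj₂ (eventuallyConstant V))
        stable : ∀ V 𝔞 → 𝔞 ⊑ stage V → μ̃ μ S 𝔞 V ≈ᵣ ν V
        stable V = proj₂ (proj₂ (eventuallyConstant V))
        scale : NonZeroIdeal → ℚ
        scale 𝔞 = card (ideal 𝔞) U ÷ card (ideal 𝔞) (residues S 𝔞)

    -- Divisibility implies inclusion, so the net has reached its constant value at all multiples of
    -- `𝔟`.
    isProcounting : IsProcounting μ S procounting
    isProcounting V ε 0<ε = let (q , 𝔟 , stable) = eventuallyConstant V in
      𝔟 , λ 𝔞 (𝔠 , 𝔞⊆ , _) → let e = stable 𝔞 (λ x∈ → ·-⊆ˡ (ideal 𝔟) 𝔠 (𝔞⊆ x∈)) in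
        ≈⇒<+ e 0<ε , ≈⇒<+ (≈ᵣ-sym e) 0<ε

-- Specialisation to rings of S-integers

open GlobalField using (IsGlobalField; Place; ContainsArchimedean; SIntegers; SIntegers-isDomain)
open Procounting using (Distribution; IsNormalizedHaar; Subset^; OpenlyEulerian; IsProcounting; preimage; closure)

proposition3p16 :
    (lem : ∀ ℓ → ExcludedMiddle ℓ)
    (F : HeytingField 0ℓ 0ℓ 0ℓ) → IsGlobalField F →
    (S : List (Place F)) → S ≢ [] → (arch : ContainsArchimedean F S) →
    let D   = SIntegers F S arch
        dom = SIntegers-isDomain F S arch
    in
    (μ : Distribution lem D dom) → IsNormalizedHaar lem D dom μ →
    (k : ℕ) (f : Fin k → List (CommutativeRing.Carrier D)) (X : Subset^ lem D dom k) →
    OpenlyEulerian lem D dom X →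
    ∃ λ (ν : Distribution lem D dom) →
      IsProcounting lem D dom μ (preimage lem D dom f (closure lem D dom X)) ν
proposition3p16 lem F _ S _ arch μ haar k f X eulerian = procounting , isProcounting
  where
    open ProcountingTheory lem (SIntegers F S arch) (SIntegers-isDomain F S arch)
    open Equidistribution μ haar f X eulerian
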